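{- Let $m,n$ be distinct square-free rational integers such that $K=\mathbb{Q}(\sqrt{m},\sqrt{n})$ is a quartic number field, let $\mathcal{A}=\mathbb{Z}[\sqrt{m},\sqrt{n}]$, and let $\sigma,\tau$ be any two different non-zero ring endomorphisms of $\mathcal{A}$. Then the $\mathbb{Z}$-module $\mathcal{D}_{(\sigma,\tau)}(\mathcal{A})$ is finitely generated of rank $4$.
   Context: $\mathcal{D}_{(\sigma,\tau)}(\mathcal{A})$ is the $\mathbb{Z}$-module (under pointwise operations) of all $(\sigma,\tau)$-derivations of $\mathcal{A}$, i.e. of all $\mathbb{Z}$-linear maps $D:\mathcal{A}\to\mathcal{A}$ with $D(xy)=D(x)\tau(y)+\sigma(x)D(y)$ for all $x,y\in\mathcal{A}$. -}

module Defs where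

open import Algebra.Apartness.Bundles using (HeytingField; HeytingCommutativeRing)
open import Algebra.Bundles using (CommutativeRing; Ring)
open import Algebra.Bundles.Raw using (RawRing)
open import Algebra.Module.Bundles using (LeftModule)
open import Algebra.Module.Morphism.Structures using (module LeftModuleMorphisms)
open import Algebra.Morphism.Structures
  using (module RingMorphisms; module RingWithoutOneMorphisms)
import Algebra.Morphism.RingMonomorphism as RingMonomorphism
import Algebra.Properties.AbelianGroup as AbelianGroupProperties
import Algebra.Properties.CommutativeSemigroup as CommutativeSemigroupProperties
import Algebra.Properties.Monoid.Sum as MonoidSum
import Algebra.Properties.Ring as RingProperties
open import Data.Integer.Base as ℤ using (ℤ; +_; ∣_∣)
open import Data.Integer.Divisibility using () renaming (_∣_ to _ℤ∣_)
import Data.Integer.Properties as ℤ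
open import Data.Nat.Base using (ℕ; _≤_)
open import Data.Product.Base using (Σ; Σ-syntax; ∃-syntax; _×_; _,_; proj₁; proj₂)
open import Data.Rational.Base as ℚ using (ℚ)
open import Data.Rational.Literals using (fromℤ)
import Data.Rational.Properties as ℚ
open import Data.Vec.Functional using (Vector)
open import Function.Base using (_∘_)
open import Level using (Level; _⊔_; suc)
open import Relation.Binary.PropositionalEquality as ≡ using (_≡_)
open import Relation.Nullary.Negation using (¬_)

SquareFree : ℤ → Set
SquareFree m = ∀ (d : ℤ) → (d ℤ.* d) ℤ∣ m → ∣ d ∣ ≡ 1

module LinearAlgebra {r ℓr m ℓm : Level} {R : Ring r ℓr} (M : LeftModule R m ℓm) where

  open Ring R using (Carrier; _≈_; 0#)
  open LeftModule M using (Carrierᴹ; _≈ᴹ_; _*ₗ_; 0ᴹ; +ᴹ-monoid)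
  open MonoidSum +ᴹ-monoid using (sum)

  linearCombination : ∀ {n} → Vector Carrier n → Vector Carrierᴹ n → Carrierᴹ
  linearCombination c v = sum (λ i → c i *ₗ v i)

  LinearlyIndependent : ∀ {n} → Vector Carrierᴹ n → Set (r ⊔ ℓr ⊔ ℓm)
  LinearlyIndependent v = ∀ c → linearCombination c v ≈ᴹ 0ᴹ → ∀ i → c i ≈ 0#

  Spans : ∀ {n} → Vector Carrierᴹ n → Set (r ⊔ m ⊔ ℓm)
  Spans v = ∀ x → ∃[ c ] x ≈ᴹ linearCombination c v

  FinitelyGenerated : Set (r ⊔ m ⊔ ℓm)
  FinitelyGenerated = ∃[ n ] Σ[ v ∈ Vector Carrierᴹ n ] Spans v

  HasBasisOfSize : ℕ → Set (r ⊔ ℓr ⊔ m ⊔ ℓm)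
  HasBasisOfSize n = Σ[ v ∈ Vector Carrierᴹ n ] LinearlyIndependent v × Spans v

  -- The rank of a module over an integral domain: the largest size of a
  -- linearly independent family.
  HasRank : ℕ → Set (r ⊔ ℓr ⊔ m ⊔ ℓm)
  HasRank n =
    (Σ[ v ∈ Vector Carrierᴹ n ] LinearlyIndependent v) ×
    (∀ k (v : Vector Carrierᴹ k) → LinearlyIndependent v → k ≤ n)

record CommutativeAlgebra {r ℓr} (R : CommutativeRing r ℓr) (a ℓ : Level) :
                          Set (r ⊔ ℓr ⊔ suc (a ⊔ ℓ)) where
  private module R = CommutativeRing R
  field
    commutativeRing : CommutativeRing a ℓ
  open CommutativeRing commutativeRing public
  open RingMorphisms R.rawRing rawRing using (IsRingHomomorphism)
  field
    ⟦_⟧                : R.Carrier → Carrier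
    isRingHomomorphism : IsRingHomomorphism ⟦_⟧
  open IsRingHomomorphism isRingHomomorphism public
    using (⟦⟧-cong; +-homo; *-homo; 0#-homo; 1#-homo; -‿homo)

  leftModule : LeftModule R.ring a ℓ
  leftModule = record
    { Carrierᴹ     = Carrier
    ; _≈ᴹ_         = _≈_
    ; _+ᴹ_         = _+_
    ; _*ₗ_         = λ k x → ⟦ k ⟧ * x
    ; 0ᴹ           = 0#
    ; -ᴹ_          = -_
    ; isLeftModule = record
      { isLeftSemimodule = record
        { +ᴹ-isCommutativeMonoid = +-isCommutativeMonoid
        ; isPreleftSemimodule    = record
          { *ₗ-cong      = λ k≈l x≈y → *-cong (⟦⟧-cong k≈l) x≈y
          ; *ₗ-zeroˡ     = λ x → trans (*-congʳ 0#-homo) (zeroˡ x)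
          ; *ₗ-distribʳ  = λ x k l → trans (*-congʳ (+-homo k l)) (distribʳ x ⟦ k ⟧ ⟦ l ⟧)
          ; *ₗ-identityˡ = λ x → trans (*-congʳ 1#-homo) (*-identityˡ x)
          ; *ₗ-assoc     = λ k l x → trans (*-congʳ (*-homo k l)) (*-assoc ⟦ k ⟧ ⟦ l ⟧ x)
          ; *ₗ-zeroʳ     = λ k → zeroʳ ⟦ k ⟧
          ; *ₗ-distribˡ  = λ k → distribˡ ⟦ k ⟧
          }
        }
      ; -ᴹ‿cong    = -‿cong
      ; -ᴹ‿inverse = -‿inverse
      }
    }

module Adjoin {r ℓr a ℓ : Level} {R : CommutativeRing r ℓr}
              (S : CommutativeAlgebra R a ℓ)
              (α β : CommutativeAlgebra.Carrier S) where

  private module R = CommutativeRing R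
  open CommutativeAlgebra S
  open RingMorphisms using (IsRingMonomorphism)

  -- Membership in R[α,β], the smallest R-subalgebra of S containing α and β.
  data Member : Carrier → Set (r ⊔ a ⊔ ℓ) where
    scalar : ∀ k → Member ⟦ k ⟧
    gen₁   : Member α
    gen₂   : Member β
    add    : ∀ {x y} → Member x → Member y → Member (x + y)
    mul    : ∀ {x y} → Member x → Member y → Member (x * y)
    neg    : ∀ {x} → Member x → Member (- x)
    resp   : ∀ {x y} → x ≈ y → Member x → Member y

  private
    adjoinRawRing : RawRing (r ⊔ a ⊔ ℓ) ℓ
    adjoinRawRing = record
      { Carrier = Σ Carrier Member
      ; _≈_     = λ x y → proj₁ x ≈ proj₁ y
      ; _+_     = λ x y → proj₁ x + proj₁ y , add (proj₂ x) (proj₂ y)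
      ; _*_     = λ x y → proj₁ x * proj₁ y , mul (proj₂ x) (proj₂ y)
      ; -_      = λ x → - proj₁ x , neg (proj₂ x)
      ; 0#      = 0# , resp 0#-homo (scalar R.0#)
      ; 1#      = 1# , resp 1#-homo (scalar R.1#)
      }

    proj₁-isRingMonomorphism : IsRingMonomorphism adjoinRawRing rawRing proj₁
    proj₁-isRingMonomorphism = record
      { isRingHomomorphism = record
        { isSemiringHomomorphism = record
          { isNearSemiringHomomorphism = record
            { +-isMonoidHomomorphism = record
              { isMagmaHomomorphism = record
                { isRelHomomorphism = record { cong = λ p → p }
                ; homo              = λ _ _ → refl
                }
              ; ε-homo              = refl
              }
            ; *-homo                 = λ _ _ → refl
            }
          ; 1#-homo                    = refl
          }
        ; -‿homo                 = λ _ → refl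
        }
      ; injective          = λ p → p
      }

  adjoinCommutativeRing : CommutativeRing (r ⊔ a ⊔ ℓ) ℓ
  adjoinCommutativeRing = record
    { RawRing adjoinRawRing
    ; isCommutativeRing =
        RingMonomorphism.isCommutativeRing proj₁-isRingMonomorphism isCommutativeRing
    }

  adjoin : CommutativeAlgebra R (r ⊔ a ⊔ ℓ) ℓ
  adjoin = record
    { commutativeRing    = adjoinCommutativeRing
    ; ⟦_⟧                = λ k → ⟦ k ⟧ , scalar k
    ; isRingHomomorphism = record
      { isSemiringHomomorphism = record
        { isNearSemiringHomomorphism = record
          { +-isMonoidHomomorphism = record
            { isMagmaHomomorphism = record
              { isRelHomomorphism = record { cong = ⟦⟧-cong }
              ; homo              = +-homo
              }
            ; ε-homo              = 0#-homo
            }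
          ; *-homo                 = *-homo
          }
        ; 1#-homo                    = 1#-homo
        }
      ; -‿homo                 = -‿homo
      }
    }

fromℤ-/1 : ∀ z → z ℚ./ 1 ≡ fromℤ z
fromℤ-/1 z = ℚ.↥p/↧p≡p (fromℤ z)

fromℤ-+ : ∀ i j → fromℤ (i ℤ.+ j) ≡ fromℤ i ℚ.+ fromℤ j
fromℤ-+ i j = ≡.trans (≡.sym (fromℤ-/1 (i ℤ.+ j)))
  (≡.cong (ℚ._/ 1) (≡.sym (≡.cong₂ ℤ._+_ (ℤ.*-identityʳ i) (ℤ.*-identityʳ j))))

fromℤ-* : ∀ i j → fromℤ (i ℤ.* j) ≡ fromℤ i ℚ.* fromℤ j
fromℤ-* i j = ≡.sym (fromℤ-/1 (i ℤ.* j))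

fromℤ-neg : ∀ i → fromℤ (ℤ.- i) ≡ ℚ.- fromℤ i
fromℤ-neg (+ 0)       = ≡.refl
fromℤ-neg (+ ℕ.suc _) = ≡.refl
fromℤ-neg ℤ.-[1+ _ ]  = ≡.refl

-- A field of characteristic zero is a field K with a (necessarily injective
-- and unique) ring homomorphism ℚ → K.
record ExtensionOfℚ (c ℓ₁ ℓ₂ : Level) : Set (suc (c ⊔ ℓ₁ ⊔ ℓ₂)) where
  field
    heytingField : HeytingField c ℓ₁ ℓ₂

  commutativeRing : CommutativeRing c ℓ₁
  commutativeRing =
    HeytingCommutativeRing.commutativeRing (HeytingField.heytingCommutativeRing heytingField)

  open CommutativeRing commutativeRing public
  open RingMorphisms ℚ.+-*-rawRing rawRing using (IsRingHomomorphism)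

  field
    ι                    : ℚ → Carrier
    ι-isRingHomomorphism : IsRingHomomorphism ι

  private module ι = IsRingHomomorphism ι-isRingHomomorphism

  ℚ-algebra : CommutativeAlgebra ℚ.+-*-commutativeRing c ℓ₁
  ℚ-algebra = record
    { commutativeRing    = commutativeRing
    ; ⟦_⟧                = ι
    ; isRingHomomorphism = ι-isRingHomomorphism
    }

  ℤ-algebra : CommutativeAlgebra ℤ.+-*-commutativeRing c ℓ₁
  ℤ-algebra = record
    { commutativeRing    = commutativeRing
    ; ⟦_⟧                = ι ∘ fromℤ
    ; isRingHomomorphism = record
      { isSemiringHomomorphism = record
        { isNearSemiringHomomorphism = record
          { +-isMonoidHomomorphism = record
            { isMagmaHomomorphism = record
              { isRelHomomorphism = record { cong = λ p → reflexive (≡.cong (ι ∘ fromℤ) p) }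
              ; homo              = λ i j →
                  trans (reflexive (≡.cong ι (fromℤ-+ i j))) (ι.+-homo (fromℤ i) (fromℤ j))
              }
            ; ε-homo              = ι.0#-homo
            }
          ; *-homo                 = λ i j →
              trans (reflexive (≡.cong ι (fromℤ-* i j))) (ι.*-homo (fromℤ i) (fromℤ j))
          }
        ; 1#-homo                    = ι.1#-homo
        }
      ; -‿homo                 = λ i →
          trans (reflexive (≡.cong ι (fromℤ-neg i))) (ι.-‿homo (fromℤ i))
      }
    }

  HasDegree : ℕ → Set (c ⊔ ℓ₁)
  HasDegree = LinearAlgebra.HasBasisOfSize (CommutativeAlgebra.leftModule ℚ-algebra)

  -- Membership in ℚ(α,β), the smallest subfield containing α and β.
  data _∈ℚ⟨_,_⟩ : Carrier → Carrier → Carrier → Set (c ⊔ ℓ₁) where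
    rational : ∀ {α β} q → ι q ∈ℚ⟨ α , β ⟩
    gen₁     : ∀ {α β} → α ∈ℚ⟨ α , β ⟩
    gen₂     : ∀ {α β} → β ∈ℚ⟨ α , β ⟩
    add      : ∀ {α β x y} → x ∈ℚ⟨ α , β ⟩ → y ∈ℚ⟨ α , β ⟩ → (x + y) ∈ℚ⟨ α , β ⟩
    mul      : ∀ {α β x y} → x ∈ℚ⟨ α , β ⟩ → y ∈ℚ⟨ α , β ⟩ → (x * y) ∈ℚ⟨ α , β ⟩
    neg      : ∀ {α β x} → x ∈ℚ⟨ α , β ⟩ → (- x) ∈ℚ⟨ α , β ⟩
    inv      : ∀ {α β x y} → x * y ≈ 1# → x ∈ℚ⟨ α , β ⟩ → y ∈ℚ⟨ α , β ⟩
    resp     : ∀ {α β x y} → x ≈ y → x ∈ℚ⟨ α , β ⟩ → y ∈ℚ⟨ α , β ⟩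

  ℤ[_,_] : Carrier → Carrier → CommutativeAlgebra ℤ.+-*-commutativeRing (c ⊔ ℓ₁) ℓ₁
  ℤ[ α , β ] = Adjoin.adjoin ℤ-algebra α β

-- Endomorphisms are not required to preserve 1; excluding the zero map is a
-- separate condition.
IsRingEndomorphism : ∀ {a ℓ} (A : CommutativeRing a ℓ) →
                     (CommutativeRing.Carrier A → CommutativeRing.Carrier A) → Set (a ⊔ ℓ)
IsRingEndomorphism A = IsRingWithoutOneHomomorphism
  where
  open RingWithoutOneMorphisms
    (RawRing.rawRingWithoutOne (CommutativeRing.rawRing A))
    (RawRing.rawRingWithoutOne (CommutativeRing.rawRing A))

module Derivations {r ℓr a ℓ : Level} {R : CommutativeRing r ℓr}
                   (A : CommutativeAlgebra R a ℓ)
                   (σ τ : CommutativeAlgebra.Carrier A → CommutativeAlgebra.Carrier A) where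

  private module R = CommutativeRing R
  open CommutativeAlgebra A
  open LeftModule leftModule
    using (_*ₗ_; rawLeftModule; *ₗ-cong; *ₗ-zeroˡ; *ₗ-zeroʳ; *ₗ-distribˡ
          ; *ₗ-distribʳ; *ₗ-identityˡ; *ₗ-assoc)
  open LeftModuleMorphisms rawLeftModule rawLeftModule using (IsLeftModuleHomomorphism)

  record Derivation : Set (r ⊔ a ⊔ ℓ) where
    field
      D        : Carrier → Carrier
      isLinear : IsLeftModuleHomomorphism D
      leibniz  : ∀ x y → D (x * y) ≈ D x * τ y + σ x * D y

    open IsLeftModuleHomomorphism isLinear public
      using () renaming (⟦⟧-cong to D-cong; +ᴹ-homo to D-+; 0ᴹ-homo to D-0; -ᴹ-homo to D-neg; *ₗ-homo to D-*ₗ)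

  open Derivation

  private
    mkLinear : ∀ {f : Carrier → Carrier} →
               (∀ {x y} → x ≈ y → f x ≈ f y) →
               (∀ x y → f (x + y) ≈ f x + f y) →
               (f 0# ≈ 0#) →
               (∀ x → f (- x) ≈ - f x) →
               (∀ k x → f (k *ₗ x) ≈ k *ₗ f x) →
               IsLeftModuleHomomorphism f
    mkLinear f-cong f-+ f-0 f-neg f-*ₗ = record
      { +ᴹ-isGroupHomomorphism = record
        { isMonoidHomomorphism = record
          { isMagmaHomomorphism = record
            { isRelHomomorphism = record { cong = f-cong }
            ; homo              = f-+
            }
          ; ε-homo              = f-0
          }
        ; ⁻¹-homo              = f-neg
        }
      ; *ₗ-homo                = f-*ₗ
      }

    open RingProperties ring using (-‿distribˡ-*; -‿distribʳ-*; -0#≈0#)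
    open AbelianGroupProperties +-abelianGroup using (⁻¹-∙-comm)
    open CommutativeSemigroupProperties +-commutativeSemigroup using (interchange)
    open CommutativeSemigroupProperties *-commutativeSemigroup using (x∙yz≈y∙xz)

  _+ᴰ_ : Derivation → Derivation → Derivation
  E +ᴰ F = record
    { D        = λ x → D E x + D F x
    ; isLinear = mkLinear
        (λ p → +-cong (D-cong E p) (D-cong F p))
        (λ x y → trans (+-cong (D-+ E x y) (D-+ F x y)) (interchange _ _ _ _))
        (trans (+-cong (D-0 E) (D-0 F)) (+-identityˡ 0#))
        (λ x → trans (+-cong (D-neg E x) (D-neg F x)) (⁻¹-∙-comm _ _))
        (λ k x → trans (+-cong (D-*ₗ E k x) (D-*ₗ F k x)) (sym (*ₗ-distribˡ k _ _)))
    ; leibniz  = λ x y → trans (+-cong (leibniz E x y) (leibniz F x y))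
        (trans (interchange _ _ _ _)
               (+-cong (sym (distribʳ _ _ _)) (sym (distribˡ _ _ _))))
    }

  0ᴰ : Derivation
  0ᴰ = record
    { D        = λ _ → 0#
    ; isLinear = mkLinear (λ _ → refl) (λ _ _ → sym (+-identityˡ 0#)) refl
        (λ _ → sym -0#≈0#) (λ k _ → sym (*ₗ-zeroʳ k))
    ; leibniz  = λ x y → sym (trans (+-cong (zeroˡ _) (zeroʳ _)) (+-identityˡ 0#))
    }

  -ᴰ_ : Derivation → Derivation
  -ᴰ E = record
    { D        = λ x → - D E x
    ; isLinear = mkLinear
        (λ p → -‿cong (D-cong E p))
        (λ x y → trans (-‿cong (D-+ E x y)) (sym (⁻¹-∙-comm _ _)))
        (trans (-‿cong (D-0 E)) -0#≈0#)
        (λ x → -‿cong (D-neg E x))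
        (λ k x → trans (-‿cong (D-*ₗ E k x)) (-‿distribʳ-* _ _))
    ; leibniz  = λ x y → trans (-‿cong (leibniz E x y))
        (trans (sym (⁻¹-∙-comm _ _)) (+-cong (-‿distribˡ-* _ _) (-‿distribʳ-* _ _)))
    }

  _*ᴰ_ : R.Carrier → Derivation → Derivation
  k *ᴰ E = record
    { D        = λ x → k *ₗ D E x
    ; isLinear = mkLinear
        (λ p → *-congˡ (D-cong E p))
        (λ x y → trans (*-congˡ (D-+ E x y)) (*ₗ-distribˡ k _ _))
        (trans (*-congˡ (D-0 E)) (*ₗ-zeroʳ k))
        (λ x → trans (*-congˡ (D-neg E x)) (sym (-‿distribʳ-* _ _)))
        (λ l x → trans (*-congˡ (D-*ₗ E l x)) (x∙yz≈y∙xz _ _ _))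
    ; leibniz  = λ x y → trans (*-congˡ (leibniz E x y))
        (trans (*ₗ-distribˡ k _ _) (+-cong (sym (*-assoc _ _ _)) (x∙yz≈y∙xz _ _ _)))
    }

  derivationModule : LeftModule R.ring (r ⊔ a ⊔ ℓ) (a ⊔ ℓ)
  derivationModule = record
    { Carrierᴹ     = Derivation
    ; _≈ᴹ_         = λ E F → ∀ x → D E x ≈ D F x
    ; _+ᴹ_         = _+ᴰ_
    ; _*ₗ_         = _*ᴰ_
    ; 0ᴹ           = 0ᴰ
    ; -ᴹ_          = -ᴰ_
    ; isLeftModule = record
      { isLeftSemimodule = record
        { +ᴹ-isCommutativeMonoid = record
          { isMonoid = record
            { isSemigroup = record
              { isMagma = record
                { isEquivalence = record
                  { refl  = λ _ → refl
                  ; sym   = λ p x → sym (p x)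
                  ; trans = λ p q x → trans (p x) (q x)
                  }
                ; ∙-cong        = λ p q x → +-cong (p x) (q x)
                }
              ; assoc   = λ _ _ _ _ → +-assoc _ _ _
              }
            ; identity    = (λ _ _ → +-identityˡ _) , (λ _ _ → +-identityʳ _)
            }
          ; comm     = λ _ _ _ → +-comm _ _
          }
        ; isPreleftSemimodule    = record
          { *ₗ-cong      = λ k≈l p x → *ₗ-cong k≈l (p x)
          ; *ₗ-zeroˡ     = λ _ _ → *ₗ-zeroˡ _
          ; *ₗ-distribʳ  = λ _ k l _ → *ₗ-distribʳ _ k l
          ; *ₗ-identityˡ = λ _ _ → *ₗ-identityˡ _
          ; *ₗ-assoc     = λ k l _ _ → *ₗ-assoc k l _
          ; *ₗ-zeroʳ     = λ k _ → *ₗ-zeroʳ k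
          ; *ₗ-distribˡ  = λ k _ _ _ → *ₗ-distribˡ k _ _
          }
        }
      ; -ᴹ‿cong    = λ p x → -‿cong (p x)
      ; -ᴹ‿inverse = (λ _ _ → -‿inverseˡ _) , (λ _ _ → -‿inverseʳ _)
      }
    }

{-# OPTIONS --safe #-}

-- Write δ = τ − σ. Expanding D(xy) = D(yx) gives D(x) δ(y) = D(y) δ(x), so
-- whenever δ(α) ≠ 0 a derivation is determined by D(α), through
-- D(x) = D(α) δ(x) / δ(α); conversely every g ∈ 𝒜 such that δ(α) divides g δ(x)
-- for all x is the value at α of a derivation. Hence the rank is at most that
-- of 𝒜, which is 4, and the derivations e δ, for e in a basis of 𝒜, show that
-- it is not smaller. A nonzero endomorphism of 𝒜 maps √m to ±√m and √n to ±√n.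
-- If σ and τ differ on only one of √m, √n, then all values of δ are multiples of
-- its value there, so every g ∈ 𝒜 occurs as D(α); if they differ on both, the
-- condition on g becomes √m ∣ g √n, which is solved in the coordinates given by
-- 1, √m, √n, √m√n. These span K = ℚ(√m)(√n), so they are independent because K
-- has degree 4.

module Submission where

open import Algebra.Apartness.Bundles using (HeytingField)
open import Algebra.Bundles using (CommutativeMonoid; CommutativeRing)
open import Algebra.Module.Bundles using (LeftModule)
open import Algebra.Morphism.Structures using (module RingWithoutOneMorphisms)
import Algebra.Properties.AbelianGroup as AbelianGroupProperties
import Algebra.Properties.CommutativeMonoid.Sum as Sum
import Algebra.Properties.CommutativeSemigroup as CommutativeSemigroupProperties
import Algebra.Properties.Ring as RingProperties
import Algebra.Properties.Semiring.Divisibility as Divisibility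
import Algebra.Solver.Ring as RingSolver
open import Algebra.Solver.Ring.AlmostCommutativeRing
  using (fromCommutativeRing; _-Raw-AlmostCommutative⟶_; Induced-equivalence)
open import Data.Fin.Base using (Fin; zero; suc; punchIn)
import Data.Fin.Patterns as F
open import Data.Fin.Properties using (all?; any?)
open import Data.Integer.Base as ℤ using (ℤ; +_; -[1+_])
import Data.Integer.Coprimality as ℤC
import Data.Integer.Divisibility.Signed as ℤD
import Data.Integer.GCD as ℤG
import Data.Integer.Properties as ℤ
import Data.Maybe.Base as Maybe
open import Data.Nat.Base as ℕ using (ℕ; zero; suc; _≤_; z≤n; s≤s)
open import Data.Nat.Coprimality using (GCD≡1⇒coprime)
open import Data.Nat.GCD using (GCD; GCD-*; gcd-GCD)
import Data.Nat.Properties as ℕ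
open import Data.Product.Base using (∃-syntax; _×_; _,_; proj₁; proj₂)
open import Data.Rational.Base as ℚ using (ℚ; 0ℚ; 1ℚ)
open import Data.Rational.Literals using (fromℤ)
import Data.Rational.Properties as ℚ
open import Data.Sum.Base using (_⊎_; inj₁; inj₂; [_,_]′)
open import Data.Vec.Functional using (Vector; []; _∷_; head; tail; insertAt; removeAt)
open import Data.Vec.Functional.Properties using (insertAt-lookup; insertAt-punchIn)
open import Defs
open import Function.Base using (_∘_; id)
open import Level using (_⊔_)
open import Relation.Binary.Definitions using (Decidable; WeaklyDecidable)
open import Relation.Binary.PropositionalEquality as ≡ using (_≡_; _≢_)
import Relation.Binary.Reasoning.Setoid as SetoidReasoning
open import Relation.Nullary.Decidable using (Dec; yes; no; ¬?; decidable-stable; map′)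
open import Relation.Nullary.Decidable.Core using (dec⇒maybe)
open import Relation.Nullary.Negation using (¬_; contradiction)

-- Linear combinations, elimination and bounds on independent families.

module LinearCombinations {r ℓr m ℓm} (R : CommutativeRing r ℓr)
                          (M : LeftModule (CommutativeRing.ring R) m ℓm) where

  open CommutativeRing R hiding (zero)
  open RingProperties ring using (-‿distribˡ-*)
  open AbelianGroupProperties +-abelianGroup using (x∙y⁻¹≈ε⇒x≈y; //-rightDividesˡ)
  open LeftModule M
  open AbelianGroupProperties +ᴹ-abelianGroup using () renaming (identityˡ-unique to identityˡ-uniqueᴹ)
  open LinearAlgebra M public
  open Sum +ᴹ-commutativeMonoid using (sum-remove; sum-cong-≋; sum-replicate-zero)
  open CommutativeSemigroupProperties (CommutativeMonoid.commutativeSemigroup +ᴹ-commutativeMonoid)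
    using (interchange)
  open SetoidReasoning ≈ᴹ-setoid

  linearCombination-cong : ∀ {n} {c d : Vector Carrier n} {v w : Vector Carrierᴹ n} →
    (∀ i → c i ≈ d i) → (∀ i → v i ≈ᴹ w i) → linearCombination c v ≈ᴹ linearCombination d w
  linearCombination-cong p q = sum-cong-≋ (λ i → *ₗ-cong (p i) (q i))

  linearCombination-+ : ∀ {n} (c d : Vector Carrier n) (v : Vector Carrierᴹ n) →
    linearCombination (λ i → c i + d i) v ≈ᴹ linearCombination c v +ᴹ linearCombination d v
  linearCombination-+ {zero}  c d v = ≈ᴹ-sym (+ᴹ-identityˡ 0ᴹ)
  linearCombination-+ {suc n} c d v = ≈ᴹ-trans
    (+ᴹ-cong (*ₗ-distribʳ _ _ _) (linearCombination-+ (tail c) (tail d) (tail v)))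
    (interchange _ _ _ _)

  linearCombination-+ᴹ : ∀ {n} (c : Vector Carrier n) (v w : Vector Carrierᴹ n) →
    linearCombination c (λ i → v i +ᴹ w i) ≈ᴹ linearCombination c v +ᴹ linearCombination c w
  linearCombination-+ᴹ {zero}  c v w = ≈ᴹ-sym (+ᴹ-identityˡ 0ᴹ)
  linearCombination-+ᴹ {suc n} c v w = ≈ᴹ-trans
    (+ᴹ-cong (*ₗ-distribˡ _ _ _) (linearCombination-+ᴹ (tail c) (tail v) (tail w)))
    (interchange _ _ _ _)

  linearCombination-*ₗ : ∀ {n} a (c : Vector Carrier n) (v : Vector Carrierᴹ n) →
    linearCombination (λ i → a * c i) v ≈ᴹ a *ₗ linearCombination c v
  linearCombination-*ₗ {zero}  a c v = ≈ᴹ-sym (*ₗ-zeroʳ a)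
  linearCombination-*ₗ {suc n} a c v = ≈ᴹ-trans
    (+ᴹ-cong (*ₗ-assoc _ _ _) (linearCombination-*ₗ a (tail c) (tail v)))
    (≈ᴹ-sym (*ₗ-distribˡ _ _ _))

  linearCombination-scale : ∀ {n} (c a : Vector Carrier n) (v : Vector Carrierᴹ n) →
    linearCombination c (λ i → a i *ₗ v i) ≈ᴹ linearCombination (λ i → c i * a i) v
  linearCombination-scale c a v = sum-cong-≋ (λ i → ≈ᴹ-sym (*ₗ-assoc (c i) (a i) (v i)))

  -- In the elimination below, this collects all multiples of the pivot vector into one coefficient.
  linearCombination-const : ∀ {n} (c : Vector Carrier n) x →
    ∃[ s ] linearCombination c (λ _ → x) ≈ᴹ s *ₗ x
  linearCombination-const {zero}  c x = 0# , ≈ᴹ-sym (*ₗ-zeroˡ x)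
  linearCombination-const {suc n} c x with linearCombination-const (tail c) x
  ... | s , p = head c + s , ≈ᴹ-trans (+ᴹ-congˡ p) (≈ᴹ-sym (*ₗ-distribʳ x (head c) s))

  linearCombination-remove : ∀ {n} (p : Fin (suc n)) c v →
    linearCombination c v ≈ᴹ c p *ₗ v p +ᴹ linearCombination (removeAt c p) (removeAt v p)
  linearCombination-remove p c v = sum-remove {i = p} (λ i → c i *ₗ v i)

  independent⇒unique : ∀ {n} {v : Vector Carrierᴹ n} → LinearlyIndependent v → ∀ c d →
    linearCombination c v ≈ᴹ linearCombination d v → ∀ i → c i ≈ d i
  independent⇒unique {v = v} ind c d cv≈dv i =
    x∙y⁻¹≈ε⇒x≈y (c i) (d i) (ind (λ i → c i - d i) (identityˡ-uniqueᴹ _ (linearCombination d v) (begin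
      linearCombination (λ i → c i - d i) v +ᴹ linearCombination d v
        ≈⟨ linearCombination-+ (λ i → c i - d i) d v ⟨
      linearCombination (λ i → c i - d i + d i) v
        ≈⟨ linearCombination-cong {v = v} (λ i → //-rightDividesˡ (d i) (c i)) (λ _ → ≈ᴹ-refl) ⟩
      linearCombination c v
        ≈⟨ cv≈dv ⟩
      linearCombination d v ∎)) i)

  InSpan : ∀ {n} → Vector Carrierᴹ n → Carrierᴹ → Set _
  InSpan w x = ∃[ c ] x ≈ᴹ linearCombination c w

  inSpan-+ : ∀ {n} {w : Vector Carrierᴹ n} {x y} →
             InSpan w x → InSpan w y → InSpan w (x +ᴹ y)
  inSpan-+ {w = w} (c , p) (d , q) =
    _ , ≈ᴹ-trans (+ᴹ-cong p q) (≈ᴹ-sym (linearCombination-+ c d w))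

  inSpan-*ₗ : ∀ {n} {w : Vector Carrierᴹ n} {x} a → InSpan w x → InSpan w (a *ₗ x)
  inSpan-*ₗ {w = w} a (c , p) =
    _ , ≈ᴹ-trans (*ₗ-congˡ p) (≈ᴹ-sym (linearCombination-*ₗ a c w))

  inSpan-resp : ∀ {n} {w : Vector Carrierᴹ n} {x y} → x ≈ᴹ y → InSpan w x → InSpan w y
  inSpan-resp x≈y (c , p) = c , ≈ᴹ-trans (≈ᴹ-sym x≈y) p

  module _ (_≟_ : Decidable _≈_)
           (integral : ∀ {x y} → x * y ≈ 0# → x ≈ 0# ⊎ y ≈ 0#)
           (1≉0 : ¬ 1# ≈ 0#) where

    -- Gaussian elimination on the first coordinate: with a pivot p the vectors
    -- a_p v_i − a_i v_p (i ≠ p) are independent and lie in the span of the tail of w.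
    independent⇒≤spanning : ∀ {n k} (w : Vector Carrierᴹ n) (v : Vector Carrierᴹ k) →
      LinearlyIndependent v → (∀ i → InSpan w (v i)) → k ≤ n
    independent⇒≤spanning {k = zero} w v ind span = z≤n
    -- Every `v i` is an empty combination, hence zero, so the relation with all coefficients 1
    -- would give 1 ≈ 0.
    independent⇒≤spanning {zero} {suc k} w v ind span =
      contradiction (ind (λ _ → 1#) sum≈0 zero) 1≉0
      where
      sum≈0 : linearCombination (λ _ → 1#) v ≈ᴹ 0ᴹ
      sum≈0 = ≈ᴹ-trans
        (sum-cong-≋ (λ i → ≈ᴹ-trans (*ₗ-congˡ (proj₂ (span i))) (*ₗ-zeroʳ 1#)))
        (sum-replicate-zero (suc k))
    independent⇒≤spanning {suc n} {suc k} w v ind span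
      with any? (λ i → ¬? (proj₁ (span i) zero ≟ 0#))
    -- Without a pivot all first coordinates vanish, and the tail of `w` already spans every `v i`.
    ... | no ∄pivot = ℕ.m≤n⇒m≤1+n (independent⇒≤spanning (tail w) v ind inTail)
      where
      inTail : ∀ i → InSpan (tail w) (v i)
      inTail i with span i | decidable-stable (proj₁ (span i) zero ≟ 0#) (λ a≉0 → ∄pivot (i , a≉0))
      ... | c , q | c₀≈0 = tail c , (begin
        v i                                                         ≈⟨ q ⟩
        c zero *ₗ w zero +ᴹ linearCombination (tail c) (tail w)     ≈⟨ +ᴹ-congʳ (*ₗ-congʳ c₀≈0) ⟩
        0# *ₗ w zero +ᴹ linearCombination (tail c) (tail w)         ≈⟨ +ᴹ-congʳ (*ₗ-zeroˡ _) ⟩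
        0ᴹ +ᴹ linearCombination (tail c) (tail w)                   ≈⟨ +ᴹ-identityˡ _ ⟩
        linearCombination (tail c) (tail w)                         ∎)
    ... | yes (p , aₚ≉0) = s≤s (independent⇒≤spanning (tail w) v′ ind′ span′)
      where
      a : Vector Carrier (suc k)
      a i = proj₁ (span i) zero

      rest : Vector Carrierᴹ (suc k)
      rest i = linearCombination (tail (proj₁ (span i))) (tail w)

      v≈ : ∀ i → v i ≈ᴹ a i *ₗ w zero +ᴹ rest i
      v≈ i = proj₂ (span i)

      v′ : Vector Carrierᴹ k
      v′ i = a p *ₗ v (punchIn p i) +ᴹ (- a (punchIn p i)) *ₗ v p

      elim : ∀ x y → x *ₗ (y *ₗ w zero) +ᴹ (- y) *ₗ (x *ₗ w zero) ≈ᴹ 0ᴹ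
      elim x y = begin
        x *ₗ (y *ₗ w zero) +ᴹ (- y) *ₗ (x *ₗ w zero) ≈⟨ +ᴹ-cong (*ₗ-assoc _ _ _) (*ₗ-assoc _ _ _) ⟨
        (x * y) *ₗ w zero +ᴹ ((- y) * x) *ₗ w zero   ≈⟨ *ₗ-distribʳ _ _ _ ⟨
        (x * y + (- y) * x) *ₗ w zero                ≈⟨ *ₗ-congʳ (+-cong (*-comm x y) (sym (-‿distribˡ-* y x))) ⟩
        (y * x + - (y * x)) *ₗ w zero                ≈⟨ *ₗ-congʳ (-‿inverseʳ _) ⟩
        0# *ₗ w zero                                 ≈⟨ *ₗ-zeroˡ _ ⟩
        0ᴹ                                           ∎

      span′ : ∀ i → InSpan (tail w) (v′ i)
      span′ i = inSpan-resp (≈ᴹ-sym eq) (inSpan-+ (inSpan-*ₗ (a p) (_ , ≈ᴹ-refl))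
                                                  (inSpan-*ₗ (- a j) (_ , ≈ᴹ-refl)))
        where
        j = punchIn p i
        eq : v′ i ≈ᴹ a p *ₗ rest j +ᴹ (- a j) *ₗ rest p
        eq = begin
          a p *ₗ v j +ᴹ (- a j) *ₗ v p
            ≈⟨ +ᴹ-cong (*ₗ-congˡ (v≈ j)) (*ₗ-congˡ (v≈ p)) ⟩
          a p *ₗ (a j *ₗ w zero +ᴹ rest j) +ᴹ (- a j) *ₗ (a p *ₗ w zero +ᴹ rest p)
            ≈⟨ +ᴹ-cong (*ₗ-distribˡ _ _ _) (*ₗ-distribˡ _ _ _) ⟩
          (a p *ₗ (a j *ₗ w zero) +ᴹ a p *ₗ rest j) +ᴹ ((- a j) *ₗ (a p *ₗ w zero) +ᴹ (- a j) *ₗ rest p)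
            ≈⟨ interchange _ _ _ _ ⟩
          (a p *ₗ (a j *ₗ w zero) +ᴹ (- a j) *ₗ (a p *ₗ w zero)) +ᴹ (a p *ₗ rest j +ᴹ (- a j) *ₗ rest p)
            ≈⟨ +ᴹ-congʳ (elim (a p) (a j)) ⟩
          0ᴹ +ᴹ (a p *ₗ rest j +ᴹ (- a j) *ₗ rest p)
            ≈⟨ +ᴹ-identityˡ _ ⟩
          a p *ₗ rest j +ᴹ (- a j) *ₗ rest p ∎

      ind′ : LinearlyIndependent v′
      ind′ c relation i = [ id , (λ aₚ≈0 → contradiction aₚ≈0 aₚ≉0) ]′ (integral cᵢaₚ≈0)
        where
        onVₚ = linearCombination-const (λ i → c i * - a (punchIn p i)) (v p)

        -- The relation `c` among the `v′ i`, rewritten as a relation among the `v i`: the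
        -- coefficient is `c i * a p` away from `p`, and at `p` it is the collected multiple of
        -- `v p`.
        d : Vector Carrier (suc k)
        d = insertAt (λ i → c i * a p) p (proj₁ onVₚ)

        relation′ : linearCombination d v ≈ᴹ 0ᴹ
        relation′ = begin
          linearCombination d v
            ≈⟨ linearCombination-remove p d v ⟩
          d p *ₗ v p +ᴹ linearCombination (removeAt d p) (removeAt v p)
            ≈⟨ +ᴹ-cong (*ₗ-congʳ (reflexive (insertAt-lookup _ p _)))
                       (linearCombination-cong (λ i → reflexive (insertAt-punchIn _ p _ i)) (λ _ → ≈ᴹ-refl)) ⟩
          proj₁ onVₚ *ₗ v p +ᴹ linearCombination (λ i → c i * a p) (removeAt v p)
            ≈⟨ +ᴹ-cong (≈ᴹ-sym (proj₂ onVₚ)) (≈ᴹ-sym (linearCombination-scale c _ (removeAt v p))) ⟩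
          linearCombination (λ i → c i * - a (punchIn p i)) (λ _ → v p)
            +ᴹ linearCombination c (λ i → a p *ₗ v (punchIn p i))
            ≈⟨ +ᴹ-congʳ (linearCombination-scale c _ (λ _ → v p)) ⟨
          linearCombination c (λ i → (- a (punchIn p i)) *ₗ v p)
            +ᴹ linearCombination c (λ i → a p *ₗ v (punchIn p i))
            ≈⟨ +ᴹ-comm _ _ ⟩
          linearCombination c (λ i → a p *ₗ v (punchIn p i))
            +ᴹ linearCombination c (λ i → (- a (punchIn p i)) *ₗ v p)
            ≈⟨ linearCombination-+ᴹ c _ _ ⟨
          linearCombination c v′
            ≈⟨ relation ⟩
          0ᴹ ∎

        cᵢaₚ≈0 : c i * a p ≈ 0#
        cᵢaₚ≈0 = trans (reflexive (≡.sym (insertAt-punchIn _ p _ i))) (ind d relation′ (punchIn p i))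

    -- In a relation among w with c_p ≉ 0, multiplication by c_p moves every
    -- vector into the span of the others.
    spanning⇒independent : ∀ {n} (v w : Vector Carrierᴹ n) →
      LinearlyIndependent v → Spans w → LinearlyIndependent w
    spanning⇒independent {suc n} v w ind span c relation p with c p ≟ 0#
    ... | yes cₚ≈0 = cₚ≈0
    -- The `suc n` independent vectors `c p *ₗ v i` would lie in the span of the `n` vectors that
    -- remain after `w p` is removed.
    ... | no  cₚ≉0 = contradiction
      (independent⇒≤spanning (removeAt w p) (λ i → c p *ₗ v i) ind′ (λ i → multiple (v i))) ℕ.1+n≰n
      where
      ind′ : LinearlyIndependent (λ i → c p *ₗ v i)
      ind′ d r i = [ id , (λ cₚ≈0 → contradiction cₚ≈0 cₚ≉0) ]′
        (integral (ind (λ i → d i * c p) (≈ᴹ-trans (≈ᴹ-sym (linearCombination-scale d (λ _ → c p) v)) r) i))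

      multiple : ∀ x → InSpan (removeAt w p) (c p *ₗ x)
      multiple x with span x
      ... | d , x≈ = _ , (begin
        c p *ₗ x
          ≈⟨ *ₗ-congˡ x≈ ⟩
        c p *ₗ linearCombination d w
          ≈⟨ +ᴹ-identityʳ _ ⟨
        c p *ₗ linearCombination d w +ᴹ 0ᴹ
          ≈⟨ +ᴹ-congˡ (≈ᴹ-trans (*ₗ-congˡ relation) (*ₗ-zeroʳ _)) ⟨
        c p *ₗ linearCombination d w +ᴹ (- d p) *ₗ linearCombination c w
          ≈⟨ +ᴹ-cong (linearCombination-*ₗ (c p) d w) (linearCombination-*ₗ (- d p) c w) ⟨
        linearCombination (λ i → c p * d i) w +ᴹ linearCombination (λ i → - d p * c i) w
          ≈⟨ linearCombination-+ (λ i → c p * d i) (λ i → - d p * c i) w ⟨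
        linearCombination e w
          ≈⟨ linearCombination-remove p e w ⟩
        e p *ₗ w p +ᴹ linearCombination (removeAt e p) (removeAt w p)
          ≈⟨ +ᴹ-congʳ (*ₗ-congʳ eₚ≈0) ⟩
        0# *ₗ w p +ᴹ linearCombination (removeAt e p) (removeAt w p)
          ≈⟨ +ᴹ-congʳ (*ₗ-zeroˡ _) ⟩
        0ᴹ +ᴹ linearCombination (removeAt e p) (removeAt w p)
          ≈⟨ +ᴹ-identityˡ _ ⟩
        linearCombination (removeAt e p) (removeAt w p) ∎)
        where
        -- Subtracting `d p` times the relation `c` does not change the value `c p *ₗ x`, but it
        -- cancels the coefficient at `p`.
        e : Vector Carrier (suc n)
        e i = c p * d i + - d p * c i

        eₚ≈0 : e p ≈ 0#
        eₚ≈0 = trans (+-cong (*-comm _ _) (sym (-‿distribˡ-* _ _))) (-‿inverseʳ _)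

-- Algebras over ℤ: a solver with integer constants, and endomorphisms on scalars.

ℤ-Algebra : ∀ a ℓ → Set _
ℤ-Algebra = CommutativeAlgebra ℤ.+-*-commutativeRing

module ℤ-AlgebraSolver {a ℓ} (A : ℤ-Algebra a ℓ) where
  open CommutativeAlgebra A

  scalars : ℤ.+-*-rawRing -Raw-AlmostCommutative⟶ fromCommutativeRing commutativeRing
  scalars = record
    { ⟦_⟧    = ⟦_⟧
    ; +-homo = +-homo
    ; *-homo = *-homo
    ; -‿homo = -‿homo
    ; 0-homo = 0#-homo
    ; 1-homo = 1#-homo
    }

  _scalar≟_ : WeaklyDecidable (Induced-equivalence scalars)
  i scalar≟ j = Maybe.map ⟦⟧-cong (dec⇒maybe (i ℤ.≟ j))

  open RingSolver ℤ.+-*-rawRing (fromCommutativeRing commutativeRing) scalars _scalar≟_ public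
    using (solve; _:=_; _:+_; _:*_; _:-_; :-_; con)

module _ {a ℓ} (A : ℤ-Algebra a ℓ) where
  open CommutativeAlgebra A hiding (zero)

  -- In this form, unlike a disjunction, no decision is made as to which factor vanishes.
  Integral : Set (a ⊔ ℓ)
  Integral = ∀ {x y} → ¬ x ≈ 0# → x * y ≈ 0# → y ≈ 0#

  DecidableZero : Set (a ⊔ ℓ)
  DecidableZero = ∀ x → Dec (x ≈ 0#)

  FixesScalars : (Carrier → Carrier) → Set ℓ
  FixesScalars σ = ∀ k → σ ⟦ k ⟧ ≈ ⟦ k ⟧

  unital-endomorphism-fixes-ℤ : ∀ {σ} → IsRingEndomorphism commutativeRing σ → σ 1# ≈ 1# →
                                FixesScalars σ
  unital-endomorphism-fixes-ℤ {σ} hom σ1≈1 = fix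
    where
    open RingWithoutOneMorphisms.IsRingWithoutOneHomomorphism hom using ()
      renaming (⟦⟧-cong to σ-cong; +-homo to σ-+; 0#-homo to σ-0; ⁻¹-homo to σ-neg)
    open SetoidReasoning setoid

    fix-+ : ∀ k → σ ⟦ + k ⟧ ≈ ⟦ + k ⟧
    fix-+ zero    = trans (σ-cong 0#-homo) (trans σ-0 (sym 0#-homo))
    fix-+ (suc k) = begin
      σ ⟦ + suc k ⟧          ≈⟨ σ-cong (+-homo (+ 1) (+ k)) ⟩
      σ (⟦ + 1 ⟧ + ⟦ + k ⟧)  ≈⟨ σ-+ _ _ ⟩
      σ ⟦ + 1 ⟧ + σ ⟦ + k ⟧  ≈⟨ +-cong (trans (σ-cong 1#-homo) (trans σ1≈1 (sym 1#-homo))) (fix-+ k) ⟩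
      ⟦ + 1 ⟧ + ⟦ + k ⟧      ≈⟨ +-homo (+ 1) (+ k) ⟨
      ⟦ + suc k ⟧            ∎

    fix : FixesScalars σ
    fix (+ k)    = fix-+ k
    fix -[1+ k ] = begin
      σ ⟦ -[1+ k ] ⟧     ≈⟨ σ-cong (-‿homo (+ suc k)) ⟩
      σ (- ⟦ + suc k ⟧)  ≈⟨ σ-neg _ ⟩
      - σ ⟦ + suc k ⟧    ≈⟨ -‿cong (fix-+ (suc k)) ⟩
      - ⟦ + suc k ⟧      ≈⟨ -‿homo (+ suc k) ⟨
      ⟦ -[1+ k ] ⟧       ∎

-- Derivations of an integral ℤ-algebra as quotients of multiples of δ = τ - σ.

module TwistedDerivations
  {a ℓ} (A : ℤ-Algebra a ℓ) (integral : Integral A)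
  {σ τ : CommutativeAlgebra.Carrier A → CommutativeAlgebra.Carrier A}
  (σ-isEndomorphism : IsRingEndomorphism (CommutativeAlgebra.commutativeRing A) σ)
  (τ-isEndomorphism : IsRingEndomorphism (CommutativeAlgebra.commutativeRing A) τ)
  (σ-fixes-ℤ : FixesScalars A σ) (τ-fixes-ℤ : FixesScalars A τ)
  where

  open CommutativeAlgebra A hiding (zero)
  open Derivations A σ τ
  open Derivation
  open ℤ-AlgebraSolver A
  open AbelianGroupProperties +-abelianGroup using (x≈y⇒x∙y⁻¹≈ε; x∙y⁻¹≈ε⇒x≈y)
  open Divisibility semiring public using (_∣_; _∣ʳ_; _,_; _∣0; ∣ʳ-respʳ-≈; x∣ʳyx)
  open SetoidReasoning setoid
  private
    module σ = RingWithoutOneMorphisms.IsRingWithoutOneHomomorphism σ-isEndomorphism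
    module τ = RingWithoutOneMorphisms.IsRingWithoutOneHomomorphism τ-isEndomorphism
    module Der = LinearCombinations ℤ.+-*-commutativeRing derivationModule
    module Alg = LinearCombinations ℤ.+-*-commutativeRing leftModule

  *-cancelʳ : ∀ {x y z} → ¬ z ≈ 0# → x * z ≈ y * z → x ≈ y
  *-cancelʳ {x} {y} {z} z≉0 xz≈yz = x∙y⁻¹≈ε⇒x≈y x y (integral z≉0 (begin
    z * (x - y)    ≈⟨ solve 3 (λ x y z → z :* (x :- y) := x :* z :- y :* z) refl x y z ⟩
    x * z - y * z  ≈⟨ x≈y⇒x∙y⁻¹≈ε xz≈yz ⟩
    0#             ∎))

  δ : Carrier → Carrier
  δ x = τ x - σ x

  δ-cong : ∀ {x y} → x ≈ y → δ x ≈ δ y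
  δ-cong x≈y = +-cong (τ.⟦⟧-cong x≈y) (-‿cong (σ.⟦⟧-cong x≈y))

  δ-+ : ∀ x y → δ (x + y) ≈ δ x + δ y
  δ-+ x y = trans (+-cong (τ.+-homo x y) (-‿cong (σ.+-homo x y)))
    (solve 4 (λ s t u v → s :+ t :- (u :+ v) := (s :- u) :+ (t :- v)) refl _ _ _ _)

  δ-neg : ∀ x → δ (- x) ≈ - δ x
  δ-neg x = trans (+-cong (τ.⁻¹-homo x) (-‿cong (σ.⁻¹-homo x)))
    (solve 2 (λ s t → :- s :- :- t := :- (s :- t)) refl _ _)

  δ-⟦⟧ : ∀ k → δ ⟦ k ⟧ ≈ 0#
  δ-⟦⟧ k = x≈y⇒x∙y⁻¹≈ε (trans (τ-fixes-ℤ k) (sym (σ-fixes-ℤ k)))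

  -- Adding and subtracting σ(x) τ(y) shows that δ is itself a (σ,τ)-derivation.
  δ-* : ∀ x y → δ (x * y) ≈ δ x * τ y + σ x * δ y
  δ-* x y = trans (+-cong (τ.*-homo x y) (-‿cong (σ.*-homo x y)))
    (solve 4 (λ s t u v → s :* t :- u :* v := (s :- u) :* t :+ u :* (t :- v)) refl _ _ _ _)

  δ-*ₗ : ∀ k x → δ (⟦ k ⟧ * x) ≈ ⟦ k ⟧ * δ x
  δ-*ₗ k x = begin
    δ (⟦ k ⟧ * x)                    ≈⟨ δ-* _ _ ⟩
    δ ⟦ k ⟧ * τ x + σ ⟦ k ⟧ * δ x    ≈⟨ +-cong (*-congʳ (δ-⟦⟧ k)) (*-congʳ (σ-fixes-ℤ k)) ⟩
    0# * τ x + ⟦ k ⟧ * δ x           ≈⟨ +-congʳ (zeroˡ _) ⟩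
    0# + ⟦ k ⟧ * δ x                 ≈⟨ +-identityˡ _ ⟩
    ⟦ k ⟧ * δ x                      ∎

  -- Compare the Leibniz expansions of D (x y) and D (y x).
  D-δ-comm : ∀ E x y → D E x * δ y ≈ D E y * δ x
  D-δ-comm E x y = begin
    D E x * (τ y - σ y)
      ≈⟨ solve 5 (λ d e s t u → d :* (t :- s) := (d :* t :+ u :* e) :- d :* s :- u :* e) refl
           (D E x) (D E y) (σ y) (τ y) (σ x) ⟩
    (D E x * τ y + σ x * D E y) - D E x * σ y - σ x * D E y
      ≈⟨ +-congʳ (+-congʳ (trans (sym (leibniz E x y)) (trans (D-cong E (*-comm x y)) (leibniz E y x)))) ⟩
    (D E y * τ x + σ y * D E x) - D E x * σ y - σ x * D E y
      ≈⟨ solve 5 (λ d e s t u → (e :* t :+ s :* d) :- d :* s :- u :* e := e :* (t :- u)) refl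
           (D E x) (D E y) (σ y) (τ x) (σ x) ⟩
    D E y * (τ x - σ x) ∎

  D-linearCombination : ∀ {n} (c : Vector ℤ n) (E : Vector Derivation n) x →
    D (Der.linearCombination c E) x ≈ Alg.linearCombination c (λ i → D (E i) x)
  D-linearCombination {zero}  c E x = refl
  D-linearCombination {suc n} c E x = +-congˡ (D-linearCombination (tail c) (tail E) x)

  linearCombination-*ʳ : ∀ {n} (c : Vector ℤ n) (v : Vector Carrier n) z →
    Alg.linearCombination c (λ i → v i * z) ≈ Alg.linearCombination c v * z
  linearCombination-*ʳ {zero}  c v z = sym (zeroˡ z)
  linearCombination-*ʳ {suc n} c v z = begin
    ⟦ head c ⟧ * (head v * z) + Alg.linearCombination (tail c) (λ i → tail v i * z)
      ≈⟨ +-cong (sym (*-assoc _ _ _)) (linearCombination-*ʳ (tail c) (tail v) z) ⟩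
    ⟦ head c ⟧ * head v * z + Alg.linearCombination (tail c) (tail v) * z
      ≈⟨ distribʳ _ _ _ ⟨
    Alg.linearCombination c v * z ∎

  module _ (γ g : Carrier) where

    -- This and the next closure lemmas make the set of x with γ ∣ g δ(x) a subalgebra, so that
    -- divisibility can be checked on generators.
    ∣gδ-resp : ∀ {x y} → x ≈ y → γ ∣ g * δ x → γ ∣ g * δ y
    ∣gδ-resp x≈y = ∣ʳ-respʳ-≈ (*-congˡ (δ-cong x≈y))

    ∣gδ-0 : ∀ {x} → δ x ≈ 0# → γ ∣ g * δ x
    ∣gδ-0 δx≈0 = ∣ʳ-respʳ-≈ (sym (trans (*-congˡ δx≈0) (zeroʳ g))) (γ ∣0)

    ∣gδ-⟦⟧ : ∀ k → γ ∣ g * δ ⟦ k ⟧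
    ∣gδ-⟦⟧ k = ∣gδ-0 (δ-⟦⟧ k)

    ∣gδ-+ : ∀ {x y} → γ ∣ g * δ x → γ ∣ g * δ y → γ ∣ g * δ (x + y)
    ∣gδ-+ {x} {y} (q , p) (q′ , p′) = q + q′ , (begin
      (q + q′) * γ         ≈⟨ distribʳ _ _ _ ⟩
      q * γ + q′ * γ       ≈⟨ +-cong p p′ ⟩
      g * δ x + g * δ y    ≈⟨ distribˡ _ _ _ ⟨
      g * (δ x + δ y)      ≈⟨ *-congˡ (δ-+ x y) ⟨
      g * δ (x + y)        ∎)

    ∣gδ-neg : ∀ {x} → γ ∣ g * δ x → γ ∣ g * δ (- x)
    ∣gδ-neg {x} (q , p) = - q , (begin
      - q * γ        ≈⟨ solve 2 (λ s t → :- s :* t := :- (s :* t)) refl q γ ⟩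
      - (q * γ)      ≈⟨ -‿cong p ⟩
      - (g * δ x)    ≈⟨ solve 2 (λ s t → :- (s :* t) := s :* :- t) refl g (δ x) ⟩
      g * - δ x      ≈⟨ *-congˡ (δ-neg x) ⟨
      g * δ (- x)    ∎)

    -- The quotients inherit the Leibniz rule from δ. Arbitrary quotients `q`, `q′` are allowed
    -- because the result serves both closure under products and the Leibniz rule of
    -- `quotientDerivation`.
    quotient-* : ∀ {x y q q′} → q * γ ≈ g * δ x → q′ * γ ≈ g * δ y →
                 (q * τ y + σ x * q′) * γ ≈ g * δ (x * y)
    quotient-* {x} {y} {q} {q′} p p′ = begin
      (q * τ y + σ x * q′) * γ
        ≈⟨ solve 5 (λ q q′ s t c → (q :* t :+ s :* q′) :* c := (q :* c) :* t :+ s :* (q′ :* c)) refl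
             q q′ (σ x) (τ y) γ ⟩
      (q * γ) * τ y + σ x * (q′ * γ)
        ≈⟨ +-cong (*-congʳ p) (*-congˡ p′) ⟩
      (g * δ x) * τ y + σ x * (g * δ y)
        ≈⟨ solve 5 (λ g d s t e → (g :* d) :* t :+ s :* (g :* e) := g :* (d :* t :+ s :* e)) refl
             g (δ x) (σ x) (τ y) (δ y) ⟩
      g * (δ x * τ y + σ x * δ y)
        ≈⟨ *-congˡ (δ-* x y) ⟨
      g * δ (x * y) ∎

    ∣gδ-* : ∀ {x y} → γ ∣ g * δ x → γ ∣ g * δ y → γ ∣ g * δ (x * y)
    ∣gδ-* (q , p) (q′ , p′) = _ , quotient-* p p′

    -- This is the map x ↦ g δ(x) / γ. Since γ can be cancelled, quotients are unique, and each law
    -- follows from the same law for g δ.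
    quotientDerivation : ¬ γ ≈ 0# → (∀ x → γ ∣ g * δ x) → Derivation
    quotientDerivation γ≉0 div = record
      { D        = f
      ; isLinear = record
        { +ᴹ-isGroupHomomorphism = record
          { isMonoidHomomorphism = record
            { isMagmaHomomorphism = record
              { isRelHomomorphism = record
                { cong = λ {x} {y} x≈y → by (f-γ y) (trans (f-γ x) (*-congˡ (δ-cong x≈y))) }
              ; homo              = λ x y → sym (by (f-γ (x + y)) (_∣ʳ_.equality (∣gδ-+ (div x) (div y))))
              }
            ; ε-homo              = sym (by (f-γ 0#) (trans (_∣ʳ_.equality (∣gδ-⟦⟧ (+ 0)))
                                                           (*-congˡ (δ-cong 0#-homo))))
            }
          ; ⁻¹-homo              = λ x → sym (by (f-γ (- x)) (_∣ʳ_.equality (∣gδ-neg (div x))))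
          }
        ; *ₗ-homo                = λ k x → sym (by (f-γ (⟦ k ⟧ * x)) (scaled k x))
        }
      ; leibniz  = λ x y → sym (by (f-γ (x * y)) (quotient-* (f-γ x) (f-γ y)))
      }
      where
      f : Carrier → Carrier
      f x = _∣ʳ_.quotient (div x)

      f-γ : ∀ x → f x * γ ≈ g * δ x
      f-γ x = _∣ʳ_.equality (div x)

      by : ∀ {u v w} → u * γ ≈ w → v * γ ≈ w → v ≈ u
      by p q = *-cancelʳ γ≉0 (trans q (sym p))

      scaled : ∀ k x → ⟦ k ⟧ * f x * γ ≈ g * δ (⟦ k ⟧ * x)
      scaled k x = begin
        ⟦ k ⟧ * f x * γ      ≈⟨ *-assoc _ _ _ ⟩
        ⟦ k ⟧ * (f x * γ)    ≈⟨ *-congˡ (f-γ x) ⟩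
        ⟦ k ⟧ * (g * δ x)    ≈⟨ solve 3 (λ k g d → k :* (g :* d) := g :* (k :* d)) refl ⟦ k ⟧ g (δ x) ⟩
        g * (⟦ k ⟧ * δ x)    ≈⟨ *-congˡ (δ-*ₗ k x) ⟨
        g * δ (⟦ k ⟧ * x)    ∎

  module _ {α : Carrier} (δα≉0 : ¬ δ α ≈ 0#) where

    -- By `D-δ-comm`, D(x) δ(α) = D(α) δ(x), and δ(α) can be cancelled.
    derivation-determined : ∀ E F → D E α ≈ D F α → ∀ x → D E x ≈ D F x
    derivation-determined E F Eα≈Fα x = *-cancelʳ δα≉0 (begin
      D E x * δ α    ≈⟨ D-δ-comm E x α ⟩
      D E α * δ x    ≈⟨ *-congʳ Eα≈Fα ⟩
      D F α * δ x    ≈⟨ D-δ-comm F α x ⟩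
      D F x * δ α    ∎)

    -- Evaluation at α is injective on derivations, so derivations with values `g i` at α generate
    -- as soon as the `g i` span all values at α.
    finitelyGenerated : ∀ {n} (g : Vector Carrier n) → (∀ i x → δ α ∣ g i * δ x) →
      (∀ E → Alg.InSpan g (D E α)) → Der.FinitelyGenerated
    finitelyGenerated {n} g div span = n , E , λ F → proj₁ (span F) ,
      derivation-determined F (Der.linearCombination (proj₁ (span F)) E) (begin
        D F α
          ≈⟨ proj₂ (span F) ⟩
        Alg.linearCombination (proj₁ (span F)) g
          ≈⟨ Alg.linearCombination-cong (λ _ → ≡.refl) Eα ⟨
        Alg.linearCombination (proj₁ (span F)) (λ i → D (E i) α)
          ≈⟨ D-linearCombination (proj₁ (span F)) E α ⟨
        D (Der.linearCombination (proj₁ (span F)) E) α ∎)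
      where
      E : Vector Derivation n
      E i = quotientDerivation (δ α) (g i) δα≉0 (div i)

      Eα : ∀ i → D (E i) α ≈ g i
      Eα i = *-cancelʳ δα≉0 (_∣ʳ_.equality (div i α))

    -- The derivations e_i (τ − σ) are independent; evaluation at α bounds the rank from above.
    hasRank : ∀ {n} → LinearAlgebra.HasBasisOfSize leftModule n → Der.HasRank n
    hasRank {n} (e , e-independent , e-spans) = (E , E-independent) , bound
      where
      E : Vector Derivation n
      -- The extra factor `δ α` in the numerator makes the division possible for every `e i`; the
      -- quotient is `e i * δ x`.
      E i = quotientDerivation (δ α) (e i * δ α) δα≉0 (λ x → e i * δ x ,
        solve 3 (λ u v w → u :* v :* w := u :* w :* v) refl (e i) (δ x) (δ α))

      E-independent : Der.LinearlyIndependent E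
      E-independent c relation = e-independent c (*-cancelʳ δα≉0 (begin
        Alg.linearCombination c e * δ α                ≈⟨ linearCombination-*ʳ c e (δ α) ⟨
        Alg.linearCombination c (λ i → e i * δ α)      ≈⟨ D-linearCombination c E α ⟨
        D (Der.linearCombination c E) α                ≈⟨ relation α ⟩
        0#                                             ≈⟨ zeroˡ _ ⟨
        0# * δ α                                       ∎))

      bound : ∀ k (F : Vector Derivation k) → Der.LinearlyIndependent F → k ≤ n
      bound k F F-independent = Alg.independent⇒≤spanning ℤ._≟_ (λ {i} → ℤ.i*j≡0⇒i≡0∨j≡0 i) (λ ())
        e (λ i → D (F i) α) Fα-independent (λ i → e-spans (D (F i) α))
        where
        Fα-independent : Alg.LinearlyIndependent (λ i → D (F i) α)
        Fα-independent c relation = F-independent c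
          (derivation-determined (Der.linearCombination c F) 0ᴰ
            (trans (D-linearCombination c F α) relation))

-- Arithmetic of ℚ and ℤ: zero divisors and reduced fractions.

p*q≡0⇒p≡0∨q≡0 : ∀ {p q} → p ℚ.* q ≡ 0ℚ → p ≡ 0ℚ ⊎ q ≡ 0ℚ
p*q≡0⇒p≡0∨q≡0 {p} {q} pq≡0 with p ℚ.≟ 0ℚ
... | yes p≡0 = inj₁ p≡0
... | no  p≢0 = inj₂ (begin
  q                      ≡⟨ ℚ.*-identityˡ q ⟨
  1ℚ ℚ.* q               ≡⟨ ≡.cong (ℚ._* q) (ℚ.*-inverseˡ p) ⟨
  (ℚ.1/ p ℚ.* p) ℚ.* q   ≡⟨ ℚ.*-assoc (ℚ.1/ p) p q ⟩
  ℚ.1/ p ℚ.* (p ℚ.* q)   ≡⟨ ≡.cong (ℚ.1/ p ℚ.*_) pq≡0 ⟩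
  ℚ.1/ p ℚ.* 0ℚ          ≡⟨ ℚ.*-zeroʳ (ℚ.1/ p) ⟩
  0ℚ                     ∎)
  where
  open ≡.≡-Reasoning
  instance _ = ℚ.≢-nonZero p≢0

-- With m′ = m / gcd m n and n′ = n / gcd m n.
reducedFraction : ∀ m n → m ≢ + 0 → ∃[ m′ ] ∃[ n′ ] m ℤ.* n′ ≡ n ℤ.* m′ ×
                  (∀ a b → m ℤ.* b ≡ n ℤ.* a → ∃[ t ] a ≡ t ℤ.* m′)
reducedFraction m n m≢0
  with ℤD.∣ᵤ⇒∣ {ℤG.gcd m n} {m} (ℤG.gcd[i,j]∣i m n) | ℤD.∣ᵤ⇒∣ {ℤG.gcd m n} {n} (ℤG.gcd[i,j]∣j m n)
... | ℤD.divides m′ m≡m′g | ℤD.divides n′ n≡n′g = m′ , n′ , cross , multiple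
  where
  g = ℤG.gcd m n

  instance
    g-nonZero : ℤ.NonZero g
    g-nonZero = ℤ.≢-nonZero (m≢0 ∘ ℤG.gcd[i,j]≡0⇒i≡0 m n)

  open ≡.≡-Reasoning

  cross : m ℤ.* n′ ≡ n ℤ.* m′
  cross = begin
    m ℤ.* n′           ≡⟨ ≡.cong (ℤ._* n′) m≡m′g ⟩
    m′ ℤ.* g ℤ.* n′    ≡⟨ ℤ.*-comm (m′ ℤ.* g) n′ ⟩
    n′ ℤ.* (m′ ℤ.* g)  ≡⟨ ≡.cong (n′ ℤ.*_) (ℤ.*-comm m′ g) ⟩
    n′ ℤ.* (g ℤ.* m′)  ≡⟨ ℤ.*-assoc n′ g m′ ⟨
    n′ ℤ.* g ℤ.* m′    ≡⟨ ≡.cong (ℤ._* m′) n≡n′g ⟨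
    n ℤ.* m′           ∎

  abs-factor : ∀ i i′ → i ≡ i′ ℤ.* g → ℤ.∣ i ∣ ≡ ℤ.∣ i′ ∣ ℕ.* ℤ.∣ g ∣
  abs-factor i i′ eq = ≡.trans (≡.cong ℤ.∣_∣ eq) (ℤ.abs-* i′ g)

  coprime : ℤC.Coprime m′ n′
  -- Dividing m, n and their gcd by g exhibits 1 as the gcd of m′ and n′.
  coprime = GCD≡1⇒coprime (GCD-* {c = ℤ.∣ g ∣}
    (≡.subst₂ (λ i j → GCD i j (1 ℕ.* ℤ.∣ g ∣)) (abs-factor m m′ m≡m′g) (abs-factor n n′ n≡n′g)
      (≡.subst (GCD _ _) (≡.sym (ℕ.*-identityˡ _)) (gcd-GCD ℤ.∣ m ∣ ℤ.∣ n ∣))))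

  multiple : ∀ a b → m ℤ.* b ≡ n ℤ.* a → ∃[ t ] a ≡ t ℤ.* m′
  -- Cancelling g from m b = n a leaves n′ a = b m′, and m′ is coprime to n′, so m′ divides a.
  multiple a b mb≡na
    with ℤD.∣ᵤ⇒∣ {m′} {a} (ℤC.coprime-divisor m′ n′ a coprime (ℤD.∣⇒∣ᵤ (ℤD.divides b n′a≡bm′)))
    where
    scaled : ∀ i i′ c → i ≡ i′ ℤ.* g → g ℤ.* (i′ ℤ.* c) ≡ i ℤ.* c
    scaled i i′ c eq = begin
      g ℤ.* (i′ ℤ.* c)  ≡⟨ ℤ.*-assoc g i′ c ⟨
      g ℤ.* i′ ℤ.* c    ≡⟨ ≡.cong (ℤ._* c) (ℤ.*-comm g i′) ⟩
      i′ ℤ.* g ℤ.* c    ≡⟨ ≡.cong (ℤ._* c) eq ⟨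
      i ℤ.* c           ∎

    n′a≡bm′ : n′ ℤ.* a ≡ b ℤ.* m′
    n′a≡bm′ = ℤ.*-cancelˡ-≡ g (n′ ℤ.* a) (b ℤ.* m′) (begin
      g ℤ.* (n′ ℤ.* a)  ≡⟨ scaled n n′ a n≡n′g ⟩
      n ℤ.* a           ≡⟨ mb≡na ⟨
      m ℤ.* b           ≡⟨ scaled m m′ b m≡m′g ⟨
      g ℤ.* (m′ ℤ.* b)  ≡⟨ ≡.cong (g ℤ.*_) (ℤ.*-comm m′ b) ⟩
      g ℤ.* (b ℤ.* m′)  ∎)
  ... | ℤD.divides t a≡tm′ = t , a≡tm′

-- The family 1, α, β, αβ.

-- The unit enters as ⟦ 1 ⟧, which the ring solver treats as a constant.
module Biquadratic {r ℓr a ℓ} {R : CommutativeRing r ℓr} (A : CommutativeAlgebra R a ℓ)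
                   (α β : CommutativeAlgebra.Carrier A) where

  private module R = CommutativeRing R
  open CommutativeAlgebra A hiding (zero)
  open LinearAlgebra leftModule

  biquadratic : Vector Carrier 4
  biquadratic = ⟦ R.1# ⟧ ∷ α ∷ β ∷ α * β ∷ []

  -- The grouping p + q β, with p and q combinations of 1 and α, follows the tower obtained by
  -- adjoining first α and then β.
  expand : ∀ c → linearCombination c biquadratic ≈
           (⟦ c F.0F ⟧ + ⟦ c F.1F ⟧ * α) + (⟦ c F.2F ⟧ + ⟦ c F.3F ⟧ * α) * β
  expand c = begin
    ⟦ c F.0F ⟧ * ⟦ R.1# ⟧ + (⟦ c F.1F ⟧ * α + (⟦ c F.2F ⟧ * β + (⟦ c F.3F ⟧ * (α * β) + 0#)))
      ≈⟨ +-cong (trans (*-congˡ 1#-homo) (*-identityʳ _))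
                (+-congˡ (+-congˡ (trans (+-identityʳ _) (sym (*-assoc _ _ _))))) ⟩
    ⟦ c F.0F ⟧ + (⟦ c F.1F ⟧ * α + (⟦ c F.2F ⟧ * β + ⟦ c F.3F ⟧ * α * β))
      ≈⟨ +-assoc _ _ _ ⟨
    ⟦ c F.0F ⟧ + ⟦ c F.1F ⟧ * α + (⟦ c F.2F ⟧ * β + ⟦ c F.3F ⟧ * α * β)
      ≈⟨ +-congˡ (distribʳ _ _ _) ⟨
    (⟦ c F.0F ⟧ + ⟦ c F.1F ⟧ * α) + (⟦ c F.2F ⟧ + ⟦ c F.3F ⟧ * α) * β ∎
    where open SetoidReasoning setoid

-- Finite extensions of ℚ: decidable equality and towers of square roots.

module FieldExtension {c ℓ₁ ℓ₂} (K : ExtensionOfℚ c ℓ₁ ℓ₂) {n}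
                      (degree : ExtensionOfℚ.HasDegree K (suc n)) where

  open ExtensionOfℚ K hiding (zero)
  open HeytingField heytingField using (#⇒invertible; tight)
  private
    module ℚ-alg = CommutativeAlgebra ℚ-algebra
    module ℤ-alg = CommutativeAlgebra ℤ-algebra
    module ℚ-lin = LinearCombinations ℚ.+-*-commutativeRing ℚ-alg.leftModule
    v = proj₁ degree
    v-independent = proj₁ (proj₂ degree)
    v-spans = proj₂ (proj₂ degree)
  open ℤ-AlgebraSolver ℤ-algebra
  open AbelianGroupProperties +-abelianGroup using (x≈y⇒x∙y⁻¹≈ε; x∙y⁻¹≈ε⇒x≈y)
  open SetoidReasoning setoid

  constant-combination≈0 : ∀ {q k} (u : Vector Carrier k) → ι q ≈ 0# →
                           ℚ-lin.linearCombination (λ _ → q) u ≈ 0#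
  constant-combination≈0 {k = zero}  u ιq≈0 = refl
  constant-combination≈0 {k = suc k} u ιq≈0 = trans
    (+-cong (trans (*-congʳ ιq≈0) (zeroˡ _)) (constant-combination≈0 (u ∘ suc) ιq≈0)) (+-identityˡ 0#)

  -- If `ι q` vanishes, then the coefficients all equal to `q` form a relation on the basis, which
  -- is nonempty because the degree is `suc n`.
  ι≈0⇒≡0 : ∀ {q} → ι q ≈ 0# → q ≡ 0ℚ
  ι≈0⇒≡0 {q} ιq≈0 = v-independent (λ _ → q) (constant-combination≈0 v ιq≈0) zero

  -- An element vanishes exactly when its rational coordinates do, and equality in ℚ is decidable.
  ≈0? : DecidableZero ℤ-algebra
  ≈0? x with v-spans x
  ... | c , x≈ = map′
    (λ c≡0 → trans x≈ (trans (ℚ-lin.linearCombination-cong {v = v} c≡0 (λ _ → refl))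
                             (constant-combination≈0 v ℚ-alg.0#-homo)))
    (λ x≈0 → v-independent c (trans (sym x≈) x≈0))
    (all? (λ i → c i ℚ.≟ 0ℚ))

  1≉0 : ¬ 1# ≈ 0#
  1≉0 1≈0 = contradiction (ι≈0⇒≡0 {1ℚ} (trans ℚ-alg.1#-homo 1≈0)) (λ ())

  -- By tightness it suffices to refute that y is apart from 0; an inverse of y would turn x y ≈ 0
  -- into x ≈ 0.
  integral : Integral ℤ-algebra
  integral {x} {y} x≉0 xy≈0 = proj₁ (tight y 0#) λ y#0 →
    let y⁻¹ , y⁻¹y≈1 , _ = #⇒invertible y#0 in
    x≉0 (begin
      x                        ≈⟨ *-identityʳ x ⟨
      x * 1#                   ≈⟨ *-congˡ y⁻¹y≈1 ⟨
      -- Apartness supplies an inverse of `y - 0#` rather than of `y`; zero is rewritten as an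
      -- integer scalar so that the solver recognises it.
      x * (y⁻¹ * (y - 0#))     ≈⟨ *-congˡ (*-congˡ (+-congˡ (-‿cong (sym ℤ-alg.0#-homo)))) ⟩
      x * (y⁻¹ * (y - ℤ-alg.⟦ + 0 ⟧))
        ≈⟨ solve 3 (λ x y z → x :* (z :* (y :- con (+ 0))) := z :* (x :* y)) refl x y y⁻¹ ⟩
      y⁻¹ * (x * y)            ≈⟨ *-congˡ xy≈0 ⟩
      y⁻¹ * 0#                 ≈⟨ zeroʳ _ ⟩
      0#                       ∎)

  record IsSubfield {ℓ} (F : Carrier → Set ℓ) : Set (c ⊔ ℓ₁ ⊔ ℓ) where
    field
      ∈-resp  : ∀ {x y} → x ≈ y → F x → F y
      ∈-ι     : ∀ q → F (ι q)
      ∈-+     : ∀ {x y} → F x → F y → F (x + y)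
      ∈-*     : ∀ {x y} → F x → F y → F (x * y)
      ∈-neg   : ∀ {x} → F x → F (- x)
      inverse : ∀ {x} → F x → ¬ x ≈ 0# → ∃[ y ] F y × x * y ≈ 1#

  data Rational : Carrier → Set (c ⊔ ℓ₁) where
    rational : ∀ {x} q → x ≈ ι q → Rational x

  rational-isSubfield : IsSubfield Rational
  rational-isSubfield = record
    { ∈-resp  = λ { x≈y (rational q p) → rational q (trans (sym x≈y) p) }
    ; ∈-ι     = λ q → rational q refl
    ; ∈-+     = λ { (rational q p) (rational r s) → rational _ (trans (+-cong p s) (sym (ℚ-alg.+-homo q r))) }
    ; ∈-*     = λ { (rational q p) (rational r s) → rational _ (trans (*-cong p s) (sym (ℚ-alg.*-homo q r))) }
    ; ∈-neg   = λ { (rational q p) → rational _ (trans (-‿cong p) (sym (ℚ-alg.-‿homo q))) }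
    ; inverse = λ { (rational q p) x≉0 →
        let instance _ = ℚ.≢-nonZero {q} (λ q≡0 → x≉0 (trans p (trans (reflexive (≡.cong ι q≡0)) ℚ-alg.0#-homo)))
        in ι (ℚ.1/ q) , rational _ refl , (begin
          _ * ι (ℚ.1/ q)     ≈⟨ *-congʳ p ⟩
          ι q * ι (ℚ.1/ q)   ≈⟨ ℚ-alg.*-homo q (ℚ.1/ q) ⟨
          ι (q ℚ.* ℚ.1/ q)   ≈⟨ reflexive (≡.cong ι (ℚ.*-inverseʳ q)) ⟩
          ι 1ℚ               ≈⟨ ℚ-alg.1#-homo ⟩
          1#                 ∎) }
    }

  -- F(θ) in the form F + F θ, for θ with square in F. The coordinates need not be unique, as θ may
  -- lie in F.
  data _⟨√_⟩ {ℓ} (F : Carrier → Set ℓ) (θ : Carrier) : Carrier → Set (c ⊔ ℓ₁ ⊔ ℓ) where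
    combination : ∀ {x p q} → F p → F q → x ≈ p + q * θ → (F ⟨√ θ ⟩) x

  module _ {ℓ} {F : Carrier → Set ℓ} (F-isSubfield : IsSubfield F) {θ} (θ²∈F : F (θ * θ)) where

    open IsSubfield F-isSubfield

    ⊆⟨√⟩ : ∀ {x} → F x → (F ⟨√ θ ⟩) x
    ⊆⟨√⟩ x∈F = combination x∈F (∈-resp ℤ-alg.0#-homo (∈-ι 0ℚ))
      (sym (trans (+-congˡ (zeroˡ θ)) (+-identityʳ _)))

    √∈⟨√⟩ : (F ⟨√ θ ⟩) θ
    √∈⟨√⟩ = combination (∈-resp ℤ-alg.0#-homo (∈-ι 0ℚ)) (∈-resp ℤ-alg.1#-homo (∈-ι 1ℚ))
      (sym (trans (+-identityˡ _) (*-identityˡ θ)))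

    -- If p² − q² θ² = 0 and p + q θ ≠ 0, then p = q θ, hence p + q θ = 2 p ∈ F.
    ⟨√⟩-inverse : ∀ {x} → (F ⟨√ θ ⟩) x → ¬ x ≈ 0# → ∃[ y ] (F ⟨√ θ ⟩) y × x * y ≈ 1#
    ⟨√⟩-inverse {x} (combination {p = p} {q} p∈F q∈F x≈) x≉0
      with ≈0? (p * p - q * q * (θ * θ))
    ... | no N≉0 = let N⁻¹ , N⁻¹∈F , NN⁻¹≈1 = inverse N∈F N≉0 in
        _ , combination (∈-* p∈F N⁻¹∈F) (∈-neg (∈-* q∈F N⁻¹∈F)) refl , (begin
          x * (p * N⁻¹ + - (q * N⁻¹) * θ)             ≈⟨ *-congʳ x≈ ⟩
          (p + q * θ) * (p * N⁻¹ + - (q * N⁻¹) * θ)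
            ≈⟨ solve 4 (λ p q t i → (p :+ q :* t) :* (p :* i :+ (:- (q :* i)) :* t) :=
                                    (p :* p :- q :* q :* (t :* t)) :* i) refl p q θ N⁻¹ ⟩
          (p * p - q * q * (θ * θ)) * N⁻¹             ≈⟨ NN⁻¹≈1 ⟩
          1#                                          ∎)
      where
      N∈F : F (p * p - q * q * (θ * θ))
      N∈F = ∈-+ (∈-* p∈F p∈F) (∈-neg (∈-* (∈-* q∈F q∈F) θ²∈F))
    ... | yes N≈0 = let y , y∈F , py≈1 = inverse (∈-+ p∈F p∈F) (x≉0 ∘ trans x≈p+p) in
        y , ⊆⟨√⟩ y∈F , trans (*-congʳ x≈p+p) py≈1
      where
      p-qθ≈0 : p - q * θ ≈ 0#
      p-qθ≈0 = integral x≉0 (begin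
        x * (p - q * θ)             ≈⟨ *-congʳ x≈ ⟩
        (p + q * θ) * (p - q * θ)
          ≈⟨ solve 3 (λ p q t → (p :+ q :* t) :* (p :- q :* t) := p :* p :- q :* q :* (t :* t)) refl p q θ ⟩
        p * p - q * q * (θ * θ)     ≈⟨ N≈0 ⟩
        0#                          ∎)

      x≈p+p : x ≈ p + p
      x≈p+p = trans x≈ (+-congˡ (sym (x∙y⁻¹≈ε⇒x≈y p (q * θ) p-qθ≈0)))

    ⟨√⟩-isSubfield : IsSubfield (F ⟨√ θ ⟩)
    ⟨√⟩-isSubfield = record
      { ∈-resp  = λ { x≈y (combination p q e) → combination p q (trans (sym x≈y) e) }
      ; ∈-ι     = λ q → ⊆⟨√⟩ (∈-ι q)
      ; ∈-+     = λ { (combination {p = p} {q} p∈ q∈ e) (combination {p = p′} {q′} p′∈ q′∈ e′) →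
          combination (∈-+ p∈ p′∈) (∈-+ q∈ q′∈) (trans (+-cong e e′)
            (solve 5 (λ p q p′ q′ t → (p :+ q :* t) :+ (p′ :+ q′ :* t) := (p :+ p′) :+ (q :+ q′) :* t)
              refl p q p′ q′ θ)) }
      ; ∈-*     = λ { (combination {p = p} {q} p∈ q∈ e) (combination {p = p′} {q′} p′∈ q′∈ e′) →
          combination (∈-+ (∈-* p∈ p′∈) (∈-* (∈-* q∈ q′∈) θ²∈F)) (∈-+ (∈-* p∈ q′∈) (∈-* q∈ p′∈))
            (trans (*-cong e e′)
              (solve 5 (λ p q p′ q′ t → (p :+ q :* t) :* (p′ :+ q′ :* t) :=
                (p :* p′ :+ q :* q′ :* (t :* t)) :+ (p :* q′ :+ q :* p′) :* t) refl p q p′ q′ θ)) }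
      ; ∈-neg   = λ { (combination {p = p} {q} p∈ q∈ e) → combination (∈-neg p∈) (∈-neg q∈)
          (trans (-‿cong e) (solve 3 (λ p q t → :- (p :+ q :* t) := :- p :+ (:- q) :* t) refl p q θ)) }
      ; inverse = ⟨√⟩-inverse
      }

  ℚ⟨⟩⊆subfield : ∀ {ℓ} {F : Carrier → Set ℓ} → IsSubfield F → ∀ {α β} → F α → F β →
                 ∀ {x} → x ∈ℚ⟨ α , β ⟩ → F x
  ℚ⟨⟩⊆subfield F-isSubfield {α} {β} α∈F β∈F = go
    where
    open IsSubfield F-isSubfield
    go : ∀ {x} → x ∈ℚ⟨ α , β ⟩ → _
    go (rational q) = ∈-ι q
    go gen₁         = α∈F
    go gen₂         = β∈F
    go (add p q)    = ∈-+ (go p) (go q)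
    go (mul p q)    = ∈-* (go p) (go q)
    go (neg p)      = ∈-neg (go p)
    go (resp x≈y p) = ∈-resp x≈y (go p)
    -- The subfield supplies some inverse `y′` of `x`; since inverses are unique, it agrees with the
    -- given `y`.
    go (inv {x = x} {y} xy≈1 p) =
      let y′ , y′∈F , xy′≈1 = inverse (go p) (λ x≈0 → 1≉0 (trans (sym xy≈1) (trans (*-congʳ x≈0) (zeroˡ y))))
      in ∈-resp (begin
        y′              ≈⟨ *-identityʳ y′ ⟨
        y′ * 1#         ≈⟨ *-congˡ xy≈1 ⟨
        y′ * (x * y)    ≈⟨ solve 3 (λ x y z → z :* (x :* y) := y :* (x :* z)) refl x y y′ ⟩
        y * (x * y′)    ≈⟨ *-congˡ xy′≈1 ⟩
        y * 1#          ≈⟨ *-identityʳ y ⟩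
        y               ∎) y′∈F

  -- Adjoining α to ℚ and then β gives a subfield that contains both generators, hence everything.
  -- Unfolding membership in the two stages yields four rational coordinates.
  biquadratic-spans : ∀ {α β} p q → α * α ≈ ι p → β * β ≈ ι q → (∀ x → x ∈ℚ⟨ α , β ⟩) →
                      ℚ-lin.Spans (Biquadratic.biquadratic ℚ-algebra α β)
  biquadratic-spans {α} {β} p q α²≈p β²≈q generated x
    with ℚ⟨⟩⊆subfield (⟨√⟩-isSubfield ℚ⟨α⟩ β²∈ℚ⟨α⟩) (⊆⟨√⟩ ℚ⟨α⟩ β²∈ℚ⟨α⟩ α∈ℚ⟨α⟩) (√∈⟨√⟩ ℚ⟨α⟩ β²∈ℚ⟨α⟩) (generated x)
    where
    α²∈ℚ = rational p α²≈p
    ℚ⟨α⟩ = ⟨√⟩-isSubfield rational-isSubfield α²∈ℚ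
    α∈ℚ⟨α⟩ = √∈⟨√⟩ rational-isSubfield α²∈ℚ
    β²∈ℚ⟨α⟩ = ⊆⟨√⟩ rational-isSubfield α²∈ℚ (rational q β²≈q)
  ... | combination (combination (rational a ≈a) (rational b ≈b) e) (combination (rational c ≈c) (rational d ≈d) f) g =
    a ∷ b ∷ c ∷ d ∷ [] , (begin
      x                                           ≈⟨ g ⟩
      _ + _ * β                                   ≈⟨ +-cong (trans e (+-cong ≈a (*-congʳ ≈b)))
                                                       (*-congʳ (trans f (+-cong ≈c (*-congʳ ≈d)))) ⟩
      (ι a + ι b * α) + (ι c + ι d * α) * β       ≈⟨ Biquadratic.expand ℚ-algebra α β (a ∷ b ∷ c ∷ d ∷ []) ⟨
      _                                           ∎)

-- Endomorphisms of a domain with decidable zero and their action on square roots of integers.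

module DecidableDomain {a ℓ} (A : ℤ-Algebra a ℓ) (≈0? : DecidableZero A) (integral : Integral A) where

  open CommutativeAlgebra A hiding (zero)
  open ℤ-AlgebraSolver A
  open AbelianGroupProperties +-abelianGroup using (x≈y⇒x∙y⁻¹≈ε; x∙y⁻¹≈ε⇒x≈y)
  open SetoidReasoning setoid

  -- σ(1) is idempotent, hence 0 or 1 in a domain, and σ(1) = 0 would make σ vanish everywhere.
  nonzero-endomorphism-fixes-ℤ : ∀ {σ} → IsRingEndomorphism commutativeRing σ →
    ¬ (∀ x → σ x ≈ 0#) → FixesScalars A σ
  nonzero-endomorphism-fixes-ℤ {σ} hom σ≉0 = unital-endomorphism-fixes-ℤ A hom σ1≈1
    where
    open RingWithoutOneMorphisms.IsRingWithoutOneHomomorphism hom using ()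
      renaming (⟦⟧-cong to σ-cong; *-homo to σ-*)

    σ1≉0 : ¬ σ 1# ≈ 0#
    σ1≉0 σ1≈0 = σ≉0 λ x → begin
      σ x          ≈⟨ σ-cong (*-identityˡ x) ⟨
      σ (1# * x)   ≈⟨ σ-* 1# x ⟩
      σ 1# * σ x   ≈⟨ *-congʳ σ1≈0 ⟩
      0# * σ x     ≈⟨ zeroˡ _ ⟩
      0#           ∎

    σ1≈1 : σ 1# ≈ 1#
    σ1≈1 = x∙y⁻¹≈ε⇒x≈y (σ 1#) 1# (integral σ1≉0 (begin
      σ 1# * (σ 1# - 1#)           ≈⟨ solve 2 (λ s u → s :* (s :- u) := s :* s :- s :* u) refl (σ 1#) 1# ⟩
      σ 1# * σ 1# - σ 1# * 1#      ≈⟨ x≈y⇒x∙y⁻¹≈ε (begin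
        σ 1# * σ 1#   ≈⟨ σ-* 1# 1# ⟨
        σ (1# * 1#)   ≈⟨ σ-cong (*-identityʳ 1#) ⟩
        σ 1#          ≈⟨ *-identityʳ _ ⟨
        σ 1# * 1#     ∎) ⟩
      0#                           ∎))

  -- Since σ fixes the integer θ², the product (σ(θ) - θ)(σ(θ) + θ) vanishes.
  endomorphism-√ : ∀ {σ} → IsRingEndomorphism commutativeRing σ → FixesScalars A σ →
    ∀ {θ k} → θ * θ ≈ ⟦ k ⟧ → σ θ ≈ θ ⊎ σ θ ≈ - θ
  endomorphism-√ {σ} hom fixes {θ} {k} θ²≈k with ≈0? (σ θ - θ)
  ... | yes σθ-θ≈0 = inj₁ (x∙y⁻¹≈ε⇒x≈y (σ θ) θ σθ-θ≈0)
  ... | no  σθ-θ≉0 = inj₂ (begin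
      σ θ                ≈⟨ solve 2 (λ s t → s := (s :+ t) :- t) refl (σ θ) θ ⟩
      (σ θ + θ) - θ      ≈⟨ +-congʳ (integral σθ-θ≉0 product≈0) ⟩
      0# - θ             ≈⟨ +-identityˡ _ ⟩
      - θ                ∎)
    where
    open RingWithoutOneMorphisms.IsRingWithoutOneHomomorphism hom using ()
      renaming (⟦⟧-cong to σ-cong; *-homo to σ-*)

    product≈0 : (σ θ - θ) * (σ θ + θ) ≈ 0#
    product≈0 = begin
      (σ θ - θ) * (σ θ + θ)  ≈⟨ solve 2 (λ s t → (s :- t) :* (s :+ t) := s :* s :- t :* t) refl (σ θ) θ ⟩
      σ θ * σ θ - θ * θ      ≈⟨ x≈y⇒x∙y⁻¹≈ε (begin
        σ θ * σ θ   ≈⟨ σ-* θ θ ⟨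
        σ (θ * θ)   ≈⟨ σ-cong θ²≈k ⟩
        σ ⟦ k ⟧     ≈⟨ fixes k ⟩
        ⟦ k ⟧       ≈⟨ θ²≈k ⟨
        θ * θ       ∎) ⟩
      0#                     ∎

  module Twisted {σ τ : Carrier → Carrier}
    (σ-isEndomorphism : IsRingEndomorphism commutativeRing σ)
    (τ-isEndomorphism : IsRingEndomorphism commutativeRing τ)
    (σ≉0 : ¬ (∀ x → σ x ≈ 0#)) (τ≉0 : ¬ (∀ x → τ x ≈ 0#))
    where

    private
      σ-fixes-ℤ = nonzero-endomorphism-fixes-ℤ σ-isEndomorphism σ≉0
      τ-fixes-ℤ = nonzero-endomorphism-fixes-ℤ τ-isEndomorphism τ≉0

    open TwistedDerivations A integral σ-isEndomorphism τ-isEndomorphism σ-fixes-ℤ τ-fixes-ℤ public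

    -- σ(θ) and τ(θ) are both ±θ, and opposite when δ(θ) is nonzero, so δ(θ) = ±2θ. Recording the
    -- sign as an `s` of square 1 spares later case distinctions.
    δ-√ : ∀ {θ k} → θ * θ ≈ ⟦ k ⟧ → ¬ δ θ ≈ 0# → ∃[ s ] s * s ≈ 1# × δ θ ≈ s * (θ + θ)
    δ-√ {θ} {k} θ²≈k δθ≉0
      with endomorphism-√ σ-isEndomorphism σ-fixes-ℤ {θ} {k} θ²≈k
         | endomorphism-√ τ-isEndomorphism τ-fixes-ℤ {θ} {k} θ²≈k
    ... | inj₁ σθ≈θ  | inj₁ τθ≈θ  = contradiction (x≈y⇒x∙y⁻¹≈ε (trans τθ≈θ (sym σθ≈θ))) δθ≉0
    ... | inj₂ σθ≈-θ | inj₂ τθ≈-θ = contradiction (x≈y⇒x∙y⁻¹≈ε (trans τθ≈-θ (sym σθ≈-θ))) δθ≉0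
    ... | inj₂ σθ≈-θ | inj₁ τθ≈θ  = 1# , *-identityʳ 1# , (begin
      τ θ - σ θ         ≈⟨ +-cong τθ≈θ (-‿cong σθ≈-θ) ⟩
      θ - - θ           ≈⟨ solve 1 (λ t → t :- :- t := t :+ t) refl θ ⟩
      θ + θ             ≈⟨ *-identityˡ _ ⟨
      1# * (θ + θ)      ∎)
    ... | inj₁ σθ≈θ  | inj₂ τθ≈-θ = - 1# ,
      trans (solve 1 (λ u → (:- u) :* (:- u) := u :* u) refl 1#) (*-identityʳ 1#) , (begin
      τ θ - σ θ         ≈⟨ +-cong τθ≈-θ (-‿cong σθ≈θ) ⟩
      - θ - θ           ≈⟨ solve 1 (λ t → :- t :- t := :- (t :+ t)) refl θ ⟩
      - (θ + θ)         ≈⟨ -‿cong (*-identityˡ _) ⟨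
      - (1# * (θ + θ))  ≈⟨ solve 2 (λ u t → :- (u :* t) := (:- u) :* t) refl 1# (θ + θ) ⟩
      - 1# * (θ + θ)    ∎)

    module _ {α β k l} (α²≈k : α * α ≈ ⟦ k ⟧) (β²≈l : β * β ≈ ⟦ l ⟧)
             (δα≉0 : ¬ δ α ≈ 0#) (δβ≉0 : ¬ δ β ≈ 0#) where

      private
        s = proj₁ (δ-√ {k = k} α²≈k δα≉0)
        s²≈1 = proj₁ (proj₂ (δ-√ {k = k} α²≈k δα≉0))
        δα≈ = proj₂ (proj₂ (δ-√ {k = k} α²≈k δα≉0))
        t = proj₁ (δ-√ {k = l} β²≈l δβ≉0)
        t²≈1 = proj₁ (proj₂ (δ-√ {k = l} β²≈l δβ≉0))
        δβ≈ = proj₂ (proj₂ (δ-√ {k = l} β²≈l δβ≉0))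

      -- With δ(α) = 2sα and δ(β) = 2tβ, where s² = t² = 1, a quotient q of gβ by α becomes the
      -- quotient stq of g δ(β) by δ(α).
      ∣⇒δ∣δ : ∀ {g} → α ∣ g * β → δ α ∣ g * δ β
      ∣⇒δ∣δ {g} (q , qα≈gβ) = s * t * q , (begin
        s * t * q * δ α               ≈⟨ *-congˡ δα≈ ⟩
        s * t * q * (s * (α + α))
          ≈⟨ solve 4 (λ s t q a → s :* t :* q :* (s :* (a :+ a)) := (s :* s) :* t :* (q :* a :+ q :* a)) refl s t q α ⟩
        (s * s) * t * (q * α + q * α) ≈⟨ *-cong (trans (*-congʳ s²≈1) (*-identityˡ t)) (+-cong qα≈gβ qα≈gβ) ⟩
        t * (g * β + g * β)
          ≈⟨ solve 3 (λ t g b → t :* (g :* b :+ g :* b) := g :* (t :* (b :+ b))) refl t g β ⟩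
        g * (t * (β + β))             ≈⟨ *-congˡ δβ≈ ⟨
        g * δ β                       ∎)

      -- In this direction the common factor 2 of δ(α) and δ(β) is cancelled.
      δ∣δ⇒∣ : ∀ {g} → ¬ ⟦ + 2 ⟧ ≈ 0# → δ α ∣ g * δ β → α ∣ g * β
      δ∣δ⇒∣ {g} 2≉0 (q , qδα≈gδβ) = t * s * q , *-cancelʳ 2≉0 (begin
        t * s * q * α * ⟦ + 2 ⟧
          ≈⟨ solve 4 (λ s t q a → t :* s :* q :* a :* con (+ 2) := t :* (q :* (s :* (a :+ a)))) refl s t q α ⟩
        t * (q * (s * (α + α)))       ≈⟨ *-congˡ (trans (*-congˡ (sym δα≈)) (trans qδα≈gδβ (*-congˡ δβ≈))) ⟩
        t * (g * (t * (β + β)))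
          ≈⟨ solve 3 (λ t g b → t :* (g :* (t :* (b :+ b))) := (t :* t) :* (g :* b :* con (+ 2))) refl t g β ⟩
        (t * t) * (g * β * ⟦ + 2 ⟧)   ≈⟨ *-congʳ t²≈1 ⟩
        1# * (g * β * ⟦ + 2 ⟧)        ≈⟨ *-identityˡ _ ⟩
        g * β * ⟦ + 2 ⟧               ∎)

-- Coordinates in the order ℤ[√m, √n].

module BiquadraticOrder {c ℓ₁ ℓ₂} (K : ExtensionOfℚ c ℓ₁ ℓ₂) where

  open ExtensionOfℚ K

  module _ {m n : ℤ} {√m √n : Carrier}
    (√m²≈m : √m * √m ≈ ι (fromℤ m)) (√n²≈n : √n * √n ≈ ι (fromℤ n))
    (generated : ∀ x → x ∈ℚ⟨ √m , √n ⟩) (degree : HasDegree 4)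
    where

    open FieldExtension K degree
    open Adjoin ℤ-algebra √m √n using (Member; scalar; gen₁; gen₂; add; mul; neg; resp)
    open CommutativeAlgebra ℤ-algebra using (⟦_⟧; *-homo; 0#-homo; 1#-homo)
    open ℤ-AlgebraSolver ℤ-algebra
    open Biquadratic ℤ-algebra √m √n
    private
      𝒜 = ℤ[ √m , √n ]
      module 𝒜 = CommutativeAlgebra 𝒜
      module Lin = LinearCombinations ℤ.+-*-commutativeRing (CommutativeAlgebra.leftModule ℤ-algebra)
      module Lin𝒜 = LinearCombinations ℤ.+-*-commutativeRing 𝒜.leftModule
      module Linℚ = LinearCombinations ℚ.+-*-commutativeRing (CommutativeAlgebra.leftModule ℚ-algebra)
    open SetoidReasoning setoid

    -- Four vectors that span a rational space of dimension 4 are independent. An integer relation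
    -- is by definition the rational one with coefficients `fromℤ (c i)`, and numerators recover the
    -- integers.
    independent : Lin.LinearlyIndependent biquadratic
    independent c relation i = ≡.cong ℚ.numerator
      (Linℚ.spanning⇒independent ℚ._≟_ p*q≡0⇒p≡0∨q≡0 (λ ()) (proj₁ degree) (Biquadratic.biquadratic ℚ-algebra √m √n)
        (proj₁ (proj₂ degree)) (biquadratic-spans (fromℤ m) (fromℤ n) √m²≈m √n²≈n generated)
        (fromℤ ∘ c) relation i)

    -- Multiplication by √m and by √n in the coordinates 1, √m, √n, √m√n.
    √m* √n* : Vector ℤ 4 → Vector ℤ 4
    √m* c = m ℤ.* c F.1F ∷ c F.0F ∷ m ℤ.* c F.3F ∷ c F.2F ∷ []
    √n* c = n ℤ.* c F.2F ∷ n ℤ.* c F.3F ∷ c F.0F ∷ c F.1F ∷ []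

    √m*-combination : ∀ c → √m * Lin.linearCombination c biquadratic ≈ Lin.linearCombination (√m* c) biquadratic
    √m*-combination c = begin
      √m * Lin.linearCombination c biquadratic
        ≈⟨ *-congˡ (expand c) ⟩
      √m * ((⟦ c F.0F ⟧ + ⟦ c F.1F ⟧ * √m) + (⟦ c F.2F ⟧ + ⟦ c F.3F ⟧ * √m) * √n)
        ≈⟨ solve 6 (λ p q r s a b → a :* ((p :+ q :* a) :+ (r :+ s :* a) :* b) :=
                     ((a :* a) :* q :+ p :* a) :+ ((a :* a) :* s :+ r :* a) :* b) refl
             ⟦ c F.0F ⟧ ⟦ c F.1F ⟧ ⟦ c F.2F ⟧ ⟦ c F.3F ⟧ √m √n ⟩
      ((√m * √m) * ⟦ c F.1F ⟧ + ⟦ c F.0F ⟧ * √m) + ((√m * √m) * ⟦ c F.3F ⟧ + ⟦ c F.2F ⟧ * √m) * √n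
        ≈⟨ +-cong (+-congʳ (scale (c F.1F))) (*-congʳ (+-congʳ (scale (c F.3F)))) ⟩
      (⟦ m ℤ.* c F.1F ⟧ + ⟦ c F.0F ⟧ * √m) + (⟦ m ℤ.* c F.3F ⟧ + ⟦ c F.2F ⟧ * √m) * √n
        ≈⟨ expand (√m* c) ⟨
      Lin.linearCombination (√m* c) biquadratic ∎
      where
      scale : ∀ k → (√m * √m) * ⟦ k ⟧ ≈ ⟦ m ℤ.* k ⟧
      scale k = trans (*-congʳ √m²≈m) (sym (*-homo m k))

    √n*-combination : ∀ c → √n * Lin.linearCombination c biquadratic ≈ Lin.linearCombination (√n* c) biquadratic
    √n*-combination c = begin
      √n * Lin.linearCombination c biquadratic
        ≈⟨ *-congˡ (expand c) ⟩
      √n * ((⟦ c F.0F ⟧ + ⟦ c F.1F ⟧ * √m) + (⟦ c F.2F ⟧ + ⟦ c F.3F ⟧ * √m) * √n)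
        ≈⟨ solve 6 (λ p q r s a b → b :* ((p :+ q :* a) :+ (r :+ s :* a) :* b) :=
                     ((b :* b) :* r :+ (b :* b) :* s :* a) :+ (p :+ q :* a) :* b) refl
             ⟦ c F.0F ⟧ ⟦ c F.1F ⟧ ⟦ c F.2F ⟧ ⟦ c F.3F ⟧ √m √n ⟩
      ((√n * √n) * ⟦ c F.2F ⟧ + (√n * √n) * ⟦ c F.3F ⟧ * √m) + (⟦ c F.0F ⟧ + ⟦ c F.1F ⟧ * √m) * √n
        ≈⟨ +-congʳ (+-cong (scale (c F.2F)) (*-congʳ (scale (c F.3F)))) ⟩
      (⟦ n ℤ.* c F.2F ⟧ + ⟦ n ℤ.* c F.3F ⟧ * √m) + (⟦ c F.0F ⟧ + ⟦ c F.1F ⟧ * √m) * √n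
        ≈⟨ expand (√n* c) ⟨
      Lin.linearCombination (√n* c) biquadratic ∎
      where
      scale : ∀ k → (√n * √n) * ⟦ k ⟧ ≈ ⟦ n ℤ.* k ⟧
      scale k = trans (*-congʳ √n²≈n) (sym (*-homo n k))

    -- Stated with a second factor so that the induction passes through products.
    member-*-span : ∀ {x y} → Member x → Lin.InSpan biquadratic y → Lin.InSpan biquadratic (x * y)
    member-*-span (scalar k) q = Lin.inSpan-*ₗ {w = biquadratic} k q
    member-*-span gen₁ (c , y≈) = √m* c , trans (*-congˡ y≈) (√m*-combination c)
    member-*-span gen₂ (c , y≈) = √n* c , trans (*-congˡ y≈) (√n*-combination c)
    member-*-span {y = y} (add {x} {x′} p p′) q =
      Lin.inSpan-resp {w = biquadratic} (sym (distribʳ y x x′)) (Lin.inSpan-+ {w = biquadratic} (member-*-span p q) (member-*-span p′ q))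
    member-*-span {y = y} (mul {x} {x′} p p′) q =
      Lin.inSpan-resp {w = biquadratic} (sym (*-assoc x x′ y)) (member-*-span p (member-*-span p′ q))
    member-*-span {y = y} (neg {x} p) q = Lin.inSpan-resp {w = biquadratic}
      (solve 2 (λ x y → con (ℤ.- (+ 1)) :* (x :* y) := (:- x) :* y) refl x y)
      (Lin.inSpan-*ₗ {w = biquadratic} (ℤ.- (+ 1)) (member-*-span p q))
    member-*-span (resp x≈x′ p) q = Lin.inSpan-resp {w = biquadratic} (*-congʳ x≈x′) (member-*-span p q)

    member⇒inSpan : ∀ {x} → Member x → Lin.InSpan biquadratic x
    member⇒inSpan {x} p = Lin.inSpan-resp {w = biquadratic} (*-identityʳ x) (member-*-span p one)
      where
      one : Lin.InSpan biquadratic 1#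
      one = + 1 ∷ + 0 ∷ + 0 ∷ + 0 ∷ [] , (begin
        1#                                                      ≈⟨ 1#-homo ⟨
        ⟦ + 1 ⟧
          ≈⟨ solve 2 (λ a b → con (+ 1) := (con (+ 1) :+ con (+ 0) :* a) :+ (con (+ 0) :+ con (+ 0) :* a) :* b)
               refl √m √n ⟩
        (⟦ + 1 ⟧ + ⟦ + 0 ⟧ * √m) + (⟦ + 0 ⟧ + ⟦ + 0 ⟧ * √m) * √n  ≈⟨ expand (+ 1 ∷ + 0 ∷ + 0 ∷ + 0 ∷ []) ⟨
        _                                                       ∎)

    α β : 𝒜.Carrier
    α = √m , gen₁
    β = √n , gen₂

    -- Equality in `𝒜` is equality of the underlying elements of K, so the facts proved in K apply
    -- unchanged.
    basis : LinearAlgebra.HasBasisOfSize 𝒜.leftModule 4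
    basis = Biquadratic.biquadratic 𝒜 α β , independent , λ x → member⇒inSpan (proj₂ x)

    open DecidableDomain 𝒜 (λ x → ≈0? (proj₁ x)) integral

    -- Generators and rank of the module of derivations of `𝒜`.

    module _ {σ τ : 𝒜.Carrier → 𝒜.Carrier}
      (σ-isEndomorphism : IsRingEndomorphism 𝒜.commutativeRing σ)
      (τ-isEndomorphism : IsRingEndomorphism 𝒜.commutativeRing τ)
      (σ≉0 : ¬ (∀ x → σ x 𝒜.≈ 𝒜.0#)) (τ≉0 : ¬ (∀ x → τ x 𝒜.≈ 𝒜.0#))
      where

      open Twisted σ-isEndomorphism τ-isEndomorphism σ≉0 τ≉0
      open Derivations 𝒜 σ τ using (Derivation; derivationModule)
      open Derivation using (D)
      open LinearAlgebra derivationModule using (FinitelyGenerated; HasRank)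

      ∣gδ-generators : ∀ γ g → γ ∣ g 𝒜.* δ α → γ ∣ g 𝒜.* δ β → ∀ x → γ ∣ g 𝒜.* δ x
      ∣gδ-generators γ g γ∣gδα γ∣gδβ (x , x∈𝒜) = go x∈𝒜
        where
        go : ∀ {x} (p : Member x) → γ ∣ g 𝒜.* δ (x , p)
        go (scalar k)                 = ∣gδ-⟦⟧ γ g k
        go gen₁                       = γ∣gδα
        go gen₂                       = γ∣gδβ
        go (add {x} {y} p q)          = ∣gδ-+ γ g {x , p} {y , q} (go p) (go q)
        go (mul {x} {y} p q)          = ∣gδ-* γ g {x , p} {y , q} (go p) (go q)
        go (neg {x} p)                = ∣gδ-neg γ g {x , p} (go p)
        go (resp {x} {y} x≈y p)       = ∣gδ-resp γ g {x , p} {y , resp x≈y p} x≈y (go p)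

      -- Divisibility by γ = 0 with g = 1 says that δ(x) = 0, so the vanishing of δ passes from the
      -- generators to all x.
      σ≈τ : δ α 𝒜.≈ 𝒜.0# → δ β 𝒜.≈ 𝒜.0# → ∀ x → σ x 𝒜.≈ τ x
      σ≈τ δα≈0 δβ≈0 x = sym (x∙y⁻¹≈ε⇒x≈y _ _ (trans (sym (*-identityˡ _))
        (0∣x⇒x≈0 {𝒜.1# 𝒜.* δ x} (∣gδ-generators 𝒜.0# 𝒜.1# (∣gδ-0 𝒜.0# 𝒜.1# {α} δα≈0) (∣gδ-0 𝒜.0# 𝒜.1# {β} δβ≈0) x))))
        where
        open AbelianGroupProperties +-abelianGroup using (x∙y⁻¹≈ε⇒x≈y)
        open Divisibility 𝒜.semiring using (0∣x⇒x≈0)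

      -- Every g is the value at θ of some derivation, so the basis of `𝒜` serves as the list of
      -- values.
      finitelyGenerated-one : ∀ θ → ¬ δ θ 𝒜.≈ 𝒜.0# → (∀ g x → δ θ ∣ g 𝒜.* δ x) → FinitelyGenerated
      finitelyGenerated-one θ δθ≉0 div = finitelyGenerated {θ} δθ≉0 (proj₁ basis) (λ i → div _)
        (λ E → proj₂ (proj₂ basis) (D E θ))

      -- The values D(√m) are the g with √m ∣ g √n; these form the ℤ-module with
      -- basis m, √m, m′√n, √m√n, where m′ = m / gcd(m, n).
      module _ {m′ n′ : ℤ} (mn′≡nm′ : m ℤ.* n′ ≡ n ℤ.* m′)
               (multiple : ∀ a b → m ℤ.* b ≡ n ℤ.* a → ∃[ t ] a ≡ t ℤ.* m′) where

        values : Vector 𝒜.Carrier 4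
        values = 𝒜.⟦ m ⟧ ∷ α ∷ 𝒜.⟦ m′ ⟧ 𝒜.* β ∷ α 𝒜.* β ∷ []

        α∣values*β : ∀ i → α ∣ values i 𝒜.* β
        α∣values*β F.0F = α 𝒜.* β , trans
          (solve 2 (λ a b → a :* b :* a := a :* a :* b) refl √m √n) (*-congʳ √m²≈m)
        α∣values*β F.1F = β , *-comm √n √m
        α∣values*β F.2F = 𝒜.⟦ n′ ⟧ 𝒜.* α , (begin
          ⟦ n′ ⟧ * √m * √m      ≈⟨ solve 2 (λ u a → u :* a :* a := a :* a :* u) refl ⟦ n′ ⟧ √m ⟩
          √m * √m * ⟦ n′ ⟧      ≈⟨ *-congʳ √m²≈m ⟩
          ⟦ m ⟧ * ⟦ n′ ⟧        ≈⟨ *-homo m n′ ⟨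
          ⟦ m ℤ.* n′ ⟧          ≈⟨ reflexive (≡.cong ⟦_⟧ mn′≡nm′) ⟩
          ⟦ n ℤ.* m′ ⟧          ≈⟨ *-homo n m′ ⟩
          ⟦ n ⟧ * ⟦ m′ ⟧        ≈⟨ *-congʳ √n²≈n ⟨
          √n * √n * ⟦ m′ ⟧      ≈⟨ solve 2 (λ v b → b :* b :* v := v :* b :* b) refl ⟦ m′ ⟧ √n ⟩
          ⟦ m′ ⟧ * √n * √n      ∎)
        α∣values*β F.3F = β 𝒜.* β , solve 2 (λ a b → b :* b :* a := a :* b :* b) refl √m √n

        -- Here `a` and `b` are the coordinates of g and of the quotient y in √m y = √n g. The
        -- √n-coordinate gives a₀ = m b₃; the 1-coordinate gives m b₁ = n a₂, so a₂ is a multiple of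
        -- m′. The other two coordinates do not constrain `a`.
        value-coefficients : ∀ {g} a b → g ≈ Lin.linearCombination a biquadratic →
          (∀ i → √m* b i ≡ √n* a i) → ∃[ d ] g ≈ Lin.linearCombination d (proj₁ ∘ values)
        value-coefficients {g} a b g≈ coefficients = b F.3F ∷ a F.1F ∷ t ∷ a F.3F ∷ [] , (begin
          g
            ≈⟨ trans g≈ (expand a) ⟩
          (⟦ a F.0F ⟧ + ⟦ a F.1F ⟧ * √m) + (⟦ a F.2F ⟧ + ⟦ a F.3F ⟧ * √m) * √n
            ≈⟨ +-cong (+-congʳ a₀) (*-congʳ (+-congʳ a₂)) ⟩
          (⟦ m ⟧ * ⟦ b F.3F ⟧ + ⟦ a F.1F ⟧ * √m) + (⟦ t ⟧ * ⟦ m′ ⟧ + ⟦ a F.3F ⟧ * √m) * √n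
            ≈⟨ trans (+-assoc _ _ _) (+-cong (*-comm _ _) (+-congˡ
                 (trans (distribʳ _ _ _) (+-cong (*-assoc _ _ _) (*-assoc _ _ _))))) ⟩
          ⟦ b F.3F ⟧ * ⟦ m ⟧ + (⟦ a F.1F ⟧ * √m + (⟦ t ⟧ * (⟦ m′ ⟧ * √n) + ⟦ a F.3F ⟧ * (√m * √n)))
            ≈⟨ +-congˡ (+-congˡ (+-congˡ (+-identityʳ _))) ⟨
          ⟦ b F.3F ⟧ * ⟦ m ⟧ + (⟦ a F.1F ⟧ * √m + (⟦ t ⟧ * (⟦ m′ ⟧ * √n) + (⟦ a F.3F ⟧ * (√m * √n) + 0#))) ∎)
          where
          a₂-multiple = multiple (a F.2F) (b F.1F) (coefficients F.0F)

          t : ℤ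
          t = proj₁ a₂-multiple

          a₀ : ⟦ a F.0F ⟧ ≈ ⟦ m ⟧ * ⟦ b F.3F ⟧
          a₀ = trans (reflexive (≡.cong ⟦_⟧ (≡.sym (coefficients F.2F)))) (*-homo m (b F.3F))

          a₂ : ⟦ a F.2F ⟧ ≈ ⟦ t ⟧ * ⟦ m′ ⟧
          a₂ = trans (reflexive (≡.cong ⟦_⟧ (proj₂ a₂-multiple))) (*-homo t m′)

        values-span : ∀ {g} → α ∣ g 𝒜.* β → Lin𝒜.InSpan values g
        values-span {g , g∈𝒜} ((y , y∈𝒜) , yα≈gβ) =
          let a , g≈ = member⇒inSpan g∈𝒜
              b , y≈ = member⇒inSpan y∈𝒜
          in value-coefficients a b g≈
            (Lin.independent⇒unique {v = biquadratic} independent (√m* b) (√n* a) (begin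
              Lin.linearCombination (√m* b) biquadratic   ≈⟨ √m*-combination b ⟨
              √m * Lin.linearCombination b biquadratic    ≈⟨ *-congˡ y≈ ⟨
              √m * y                                      ≈⟨ *-comm √m y ⟩
              y * √m                                      ≈⟨ yα≈gβ ⟩
              g * √n                                      ≈⟨ *-comm g √n ⟩
              √n * g                                      ≈⟨ *-congˡ g≈ ⟩
              √n * Lin.linearCombination a biquadratic    ≈⟨ √n*-combination a ⟩
              Lin.linearCombination (√n* a) biquadratic   ∎))

        finitelyGenerated-values : ¬ δ α 𝒜.≈ 𝒜.0# → ¬ δ β 𝒜.≈ 𝒜.0# → FinitelyGenerated
        finitelyGenerated-values δα≉0 δβ≉0 = finitelyGenerated {α} δα≉0 values
          (λ i → ∣gδ-generators (δ α) (values i) (x∣ʳyx (δ α) (values i))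
                   (∣⇒δ∣δ {α} {β} {m} {n} √m²≈m √n²≈n δα≉0 δβ≉0 {values i} (α∣values*β i)))
          -- `D-δ-comm` exhibits D(β) as the quotient of D(α) δ(β) by δ(α).
          (λ E → values-span {D E α} (δ∣δ⇒∣ {α} {β} {m} {n} √m²≈m √n²≈n δα≉0 δβ≉0 {D E α} 2≉0 (D E β , D-δ-comm E β α)))
          where
          2≉0 : ¬ ⟦ + 2 ⟧ ≈ 0#
          2≉0 2≈0 = contradiction (ι≈0⇒≡0 2≈0) (λ ())

      finitelyGenerated-both : ¬ δ α 𝒜.≈ 𝒜.0# → ¬ δ β 𝒜.≈ 𝒜.0# → FinitelyGenerated
      finitelyGenerated-both δα≉0 δβ≉0 =
        let _ , _ , mn′≡nm′ , multiple = reducedFraction m n m≢0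
        in finitelyGenerated-values mn′≡nm′ multiple δα≉0 δβ≉0
        where
        -- `reducedFraction` asks for m ≠ 0; this holds because √m = 0 would force δ(α) = 0.
        √m≉0 : ¬ √m ≈ 0#
        √m≉0 √m≈0 = δα≉0 (trans (δ-cong {α} {𝒜.⟦ + 0 ⟧} (trans √m≈0 (sym 0#-homo))) (δ-⟦⟧ (+ 0)))

        m≢0 : m ≢ + 0
        m≢0 m≡0 = √m≉0 (integral √m≉0 (trans √m²≈m (trans (reflexive (≡.cong ⟦_⟧ m≡0)) 0#-homo)))

      finitelyGenerated∧hasRank4 : ¬ (∀ x → σ x 𝒜.≈ τ x) → FinitelyGenerated × HasRank 4
      finitelyGenerated∧hasRank4 σ≉τ = cases (≈0? (proj₁ (δ α))) (≈0? (proj₁ (δ β)))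
        where
        cases : Dec (δ α 𝒜.≈ 𝒜.0#) → Dec (δ β 𝒜.≈ 𝒜.0#) → FinitelyGenerated × HasRank 4
        cases (yes δα≈0) (yes δβ≈0) = contradiction (σ≈τ δα≈0 δβ≈0) σ≉τ
        cases (yes δα≈0) (no  δβ≉0) = finitelyGenerated-one β δβ≉0
          (λ g → ∣gδ-generators (δ β) g (∣gδ-0 (δ β) g {α} δα≈0) (x∣ʳyx (δ β) g)) , hasRank {β} δβ≉0 basis
        cases (no  δα≉0) (yes δβ≈0) = finitelyGenerated-one α δα≉0
          (λ g → ∣gδ-generators (δ α) g (x∣ʳyx (δ α) g) (∣gδ-0 (δ α) g {β} δβ≈0)) , hasRank {α} δα≉0 basis
        cases (no  δα≉0) (no  δβ≉0) = finitelyGenerated-both δα≉0 δβ≉0 , hasRank {α} δα≉0 basis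

corollary3p19 : ∀ {c ℓ₁ ℓ₂} (m n : ℤ) → m ≢ n → SquareFree m → SquareFree n →
    (K : ExtensionOfℚ c ℓ₁ ℓ₂) →
    let open ExtensionOfℚ K in
    (√m √n : Carrier) → √m * √m ≈ ι (fromℤ m) → √n * √n ≈ ι (fromℤ n) →
    (∀ x → x ∈ℚ⟨ √m , √n ⟩) → HasDegree 4 →
    let 𝒜 = ℤ[ √m , √n ]
        module 𝒜 = CommutativeAlgebra 𝒜 in
    (σ τ : 𝒜.Carrier → 𝒜.Carrier) →
    IsRingEndomorphism 𝒜.commutativeRing σ → IsRingEndomorphism 𝒜.commutativeRing τ →
    ¬ (∀ x → σ x 𝒜.≈ 𝒜.0#) → ¬ (∀ x → τ x 𝒜.≈ 𝒜.0#) → ¬ (∀ x → σ x 𝒜.≈ τ x) →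
    let open LinearAlgebra (Derivations.derivationModule 𝒜 σ τ) in
    FinitelyGenerated × HasRank 4
corollary3p19 m n _ _ _ K √m √n √m²≈m √n²≈n generated degree σ τ σ-hom τ-hom σ≉0 τ≉0 σ≉τ =
  BiquadraticOrder.finitelyGenerated∧hasRank4 K √m²≈m √n²≈n generated degree σ-hom τ-hom σ≉0 τ≉0 σ≉τ
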